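{- As $N\to\infty$, $$\sum_{k=1}^{N}\varphi(k)\,I_N\!\left(\frac{1}{k}\right)=\frac{N^3}{6\zeta(3)}+O\!\left(\frac{N^3}{\log N}\right),$$ i.e. there is a constant $C$ such that for all integers $N\ge 2$, $\left|\sum_{k=1}^{N}\varphi(k)I_N(1/k)-\frac{N^3}{6\zeta(3)}\right|\le C\,\frac{N^3}{\log N}$.
   Context: $\varphi$ is Euler's totient function and $\zeta$ is the Riemann zeta function. For a positive integer $N$, the Farey sequence of order $N$, $F_N$, is the increasing list of all reduced fractions $h/k$ with $0\le h\le k\le N$ and $\gcd(h,k)=1$; it begins with $0/1$ and ends with $1/1$. For $x\in F_N$, $I_N(x)$ denotes the position of $x$ in $F_N$, indexed starting from $1$ (so $I_N(0/1)=1$ and $I_N(1/1)=|F_N|$). -}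

module Defs where

open import Data.Nat as ℕ using (ℕ; zero; suc; z≤n; s≤s)
import Data.Nat.Properties as ℕₚ
open import Data.Nat.GCD using (gcd; gcd-zeroˡ)
open import Data.Integer as ℤ using (+_)
import Data.Integer.Properties as ℤₚ
open import Data.Rational as ℚ using (ℚ; 0ℚ; 1ℚ; ½; _/_; _+_; _*_; _-_; -_; _⊔_; 1/_; ∣_∣; _≤_; _<_)
import Data.Rational.Properties as ℚₚ
open import Data.Nat.Solver renaming (module +-*-Solver to ℕ-+-*-Solver)
open import Data.Rational.Solver using (module +-*-Solver)
import Data.Rational.Unnormalised as ℚᵘ
import Data.Rational.Unnormalised.Properties as ℚᵘₚ
open import Data.Fin using (Fin; toℕ)
open import Data.Fin.Properties using (toℕ<n)
open import Data.List using (List; length; map; filter; concatMap; upTo)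
open import Data.List.Sort ℚₚ.≤-decTotalOrder using (sort; sort-↭)
open import Data.List.Membership.Propositional using (_∈_; lose)
open import Data.List.Membership.Propositional.Properties
  using (∈-map⁺; ∈-filter⁺; ∈-concatMap⁺; ∈-upTo⁺)
open import Data.List.Relation.Unary.Any using (index)
open import Data.List.Relation.Binary.Permutation.Propositional using (↭-sym)
open import Data.List.Relation.Binary.Permutation.Propositional.Properties using (∈-resp-↭)
open import Data.Product using (_×_; _,_; proj₁; proj₂; ∃-syntax)
open import Data.Sum using (inj₁; inj₂)
open import Relation.Binary.PropositionalEquality

φ : ℕ → ℕ
φ n = length (filter (λ m → gcd (suc m) n ℕ.≟ 1) (upTo n))

-- The fractions h/k with k = suc i, 0 ≤ h ≤ k and gcd(h,k) = 1.
row : ℕ → List ℚ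
row i = map (λ h → + h / suc i)
            (filter (λ h → gcd h (suc i) ℕ.≟ 1) (upTo (suc (suc i))))

-- Reduced fractions are pairwise distinct, so the sorted list is strictly increasing.
farey : ℕ → List ℚ
farey N = sort (concatMap row (upTo N))

I : (N : ℕ) (x : ℚ) → x ∈ farey N → ℕ
I N x x∈F = suc (toℕ (index x∈F))

1/k∈farey : ∀ {N} (i : Fin N) → + 1 / suc (toℕ i) ∈ farey N
1/k∈farey {N} i = ∈-resp-↭ (↭-sym (sort-↭ (concatMap row (upTo N))))
  (∈-concatMap⁺ row {xs = upTo N}
    (lose (∈-upTo⁺ (toℕ<n i))
      (∈-map⁺ (λ h → + h / suc (toℕ i))
        (∈-filter⁺ (λ h → gcd h (suc (toℕ i)) ℕ.≟ 1)
          (∈-upTo⁺ (s≤s (s≤s z≤n))) (gcd-zeroˡ (suc (toℕ i)))))))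

∑ : ℕ → (ℕ → ℚ) → ℚ
∑ zero    f = 0ℚ
∑ (suc n) f = ∑ n f + f n

p-q≤r : ∀ {p q r} → p ≤ q + r → p - q ≤ r
p-q≤r {p} {q} {r} h = subst (p - q ≤_)
  (solve 2 (λ q r → (q :+ r) :- q := r) refl q r)
  (ℚₚ.+-monoˡ-≤ (- q) h)
  where open +-*-Solver

∣p-q∣≤r : ∀ {p q r} → p ≤ q + r → q ≤ p + r → ∣ p - q ∣ ≤ r
∣p-q∣≤r {p} {q} {r} h₁ h₂ with ℚₚ.∣p∣≡p∨∣p∣≡-p (p - q)
... | inj₁ e = subst (_≤ r) (sym e) (p-q≤r h₁)
... | inj₂ e = subst (_≤ r)
  (trans (solve 2 (λ p q → q :- p := :- (p :- q)) refl p q) (sym e)) (p-q≤r h₂)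
  where open +-*-Solver

p≤∣p∣ : ∀ p → p ≤ ∣ p ∣
p≤∣p∣ p with ℚₚ.≤-total 0ℚ p
... | inj₁ 0≤p = ℚₚ.≤-reflexive (sym (ℚₚ.0≤p⇒∣p∣≡p 0≤p))
... | inj₂ p≤0 = ℚₚ.≤-trans p≤0 (ℚₚ.0≤∣p∣ p)

∣p∣≤∣q∣+∣p-q∣ : ∀ p q → ∣ p ∣ ≤ ∣ q ∣ + ∣ p - q ∣
∣p∣≤∣q∣+∣p-q∣ p q = subst (λ z → ∣ z ∣ ≤ ∣ q ∣ + ∣ p - q ∣)
  (solve 2 (λ p q → q :+ (p :- q) := p) refl p q) (ℚₚ.∣p+q∣≤∣p∣+∣q∣ q (p - q))
  where open +-*-Solver

∣∣p∣-∣q∣∣≤∣p-q∣ : ∀ p q → ∣ ∣ p ∣ - ∣ q ∣ ∣ ≤ ∣ p - q ∣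
∣∣p∣-∣q∣∣≤∣p-q∣ p q = ∣p-q∣≤r (∣p∣≤∣q∣+∣p-q∣ p q)
  (subst (λ z → ∣ q ∣ ≤ ∣ p ∣ + z)
    (trans (sym (ℚₚ.∣-p∣≡∣p∣ (q - p)))
      (cong ∣_∣ (solve 2 (λ p q → :- (q :- p) := p :- q) refl p q)))
    (∣p∣≤∣q∣+∣p-q∣ q p))
  where open +-*-Solver

0<1/p : ∀ p (0<p : 0ℚ < p) → 0ℚ < (1/ p) {{ℚ.>-nonZero 0<p}}
0<1/p p 0<p = ℚₚ.positive⁻¹ _ {{ℚₚ.1/pos⇒pos p {{ℚ.positive 0<p}}}}

0<p*q : ∀ {p q} → 0ℚ < p → 0ℚ < q → 0ℚ < p * q
0<p*q {p} {q} 0<p 0<q =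
  ℚₚ.positive⁻¹ _ {{ℚₚ.pos*pos⇒pos p {{ℚ.positive 0<p}} q {{ℚ.positive 0<q}}}}

*-mono-≤ : ∀ {p q r s} → 0ℚ ≤ r → 0ℚ ≤ q → p ≤ q → r ≤ s → p * r ≤ q * s
*-mono-≤ {p} {q} {r} {s} 0≤r 0≤q p≤q r≤s = ℚₚ.≤-trans
  (ℚₚ.*-monoʳ-≤-nonNeg r {{ℚ.nonNegative 0≤r}} p≤q)
  (ℚₚ.*-monoˡ-≤-nonNeg q {{ℚ.nonNegative 0≤q}} r≤s)

/-mono-≤ : ∀ a b c d .{{_ : ℕ.NonZero b}} .{{_ : ℕ.NonZero d}} →
           a ℕ.* d ℕ.≤ c ℕ.* b → + a / b ≤ + c / d
/-mono-≤ a b@(suc _) c d@(suc _) h = ℚₚ.toℚᵘ-cancel-≤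
  (ℚᵘₚ.≤-respˡ-≃ (ℚᵘₚ.≃-sym (ℚₚ.toℚᵘ-fromℚᵘ (ℚᵘ.mkℚᵘ (+ a) _)))
  (ℚᵘₚ.≤-respʳ-≃ (ℚᵘₚ.≃-sym (ℚₚ.toℚᵘ-fromℚᵘ (ℚᵘ.mkℚᵘ (+ c) _)))
  (ℚᵘ.*≤* (subst₂ ℤ._≤_ (ℤₚ.pos-* a d) (ℤₚ.pos-* c b) (ℤ.+≤+ h)))))

1/-anti-≤ : ∀ m n .{{_ : ℕ.NonZero m}} .{{_ : ℕ.NonZero n}} → m ℕ.≤ n → + 1 / n ≤ + 1 / m
1/-anti-≤ m n m≤n = /-mono-≤ 1 n 1 m
  (subst₂ ℕ._≤_ (sym (ℕₚ.*-identityˡ m)) (sym (ℕₚ.*-identityˡ n)) m≤n)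

0≤a/b : ∀ a b .{{_ : ℕ.NonZero b}} → 0ℚ ≤ + a / b
0≤a/b a b = ℚₚ.nonNegative⁻¹ _ {{ℚₚ.normalize-nonNeg a b}}

0<1/n : ∀ n .{{_ : ℕ.NonZero n}} → 0ℚ < + 1 / n
0<1/n n = ℚₚ.positive⁻¹ _ {{ℚₚ.normalize-pos 1 n}}

/-+-/ : ∀ a b c d .{{_ : ℕ.NonZero b}} .{{_ : ℕ.NonZero d}} .{{_ : ℕ.NonZero (b ℕ.* d)}} →
        + a / b + + c / d ≡ + (a ℕ.* d ℕ.+ c ℕ.* b) / (b ℕ.* d)
/-+-/ a b@(suc _) c d@(suc _) = ℚₚ.toℚᵘ-injective (begin
  ℚ.toℚᵘ (+ a / b + + c / d)              ≈⟨ ℚₚ.toℚᵘ-homo-+ (+ a / b) (+ c / d) ⟩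
  ℚ.toℚᵘ (+ a / b) ℚᵘ.+ ℚ.toℚᵘ (+ c / d)  ≈⟨ ℚᵘₚ.+-cong (ℚₚ.toℚᵘ-fromℚᵘ (ℚᵘ.mkℚᵘ (+ a) _))
                                                           (ℚₚ.toℚᵘ-fromℚᵘ (ℚᵘ.mkℚᵘ (+ c) _)) ⟩
  ℚᵘ.mkℚᵘ (+ a) _ ℚᵘ.+ ℚᵘ.mkℚᵘ (+ c) _    ≡⟨ cong (λ z → ℚᵘ.mkℚᵘ z _)
                                               (cong₂ ℤ._+_ (sym (ℤₚ.pos-* a d)) (sym (ℤₚ.pos-* c b))) ⟩
  ℚᵘ.mkℚᵘ (+ (a ℕ.* d ℕ.+ c ℕ.* b)) _     ≈⟨ ℚᵘₚ.≃-sym (ℚₚ.toℚᵘ-fromℚᵘ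
                                               (ℚᵘ.mkℚᵘ (+ (a ℕ.* d ℕ.+ c ℕ.* b)) _)) ⟩
  ℚ.toℚᵘ (+ (a ℕ.* d ℕ.+ c ℕ.* b) / (b ℕ.* d)) ∎)
  where open ℚᵘₚ.≃-Reasoning

1/n≤ε : ∀ {ε} → 0ℚ < ε → ∃[ M ] (∀ n → M ℕ.≤ n → + 1 / suc n ≤ ε)
1/n≤ε {ℚ.mkℚ ℤ.+0 d _} (ℚ.*<* (ℤ.+<+ ()))
1/n≤ε {ε@(ℚ.mkℚ ℤ.+[1+ a ] d c)} _ = d , λ n d≤n →
  subst (+ 1 / suc n ≤_) (ℚₚ.↥p/↧p≡p ε)
    (/-mono-≤ 1 (suc n) (suc a) (suc d)
      (ℕₚ.*-mono-≤ {1} {suc a} (s≤s z≤n) (s≤s d≤n)))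
1/n≤ε {ℚ.mkℚ (ℤ.-[1+ _ ]) d _} (ℚ.*<* ())

IsCauchy : (ℕ → ℚ) → Set
IsCauchy s = ∀ ε → 0ℚ < ε →
  ∃[ M ] (∀ m n → M ℕ.≤ m → M ℕ.≤ n → ∣ s m - s n ∣ ≤ ε)

record ℝ : Set where
  constructor mkℝ
  field
    seq    : ℕ → ℚ
    cauchy : IsCauchy seq

open ℝ public

infix 4 _≤ℝ_ _<ℝ_

-- The slack ε is needed: the order must not depend on the representing sequences.
_≤ℝ_ : ℝ → ℝ → Set
x ≤ℝ y = ∀ ε → 0ℚ < ε → ∃[ M ] (∀ n → M ℕ.≤ n → seq x n ≤ seq y n + ε)

_<ℝ_ : ℝ → ℝ → Set
x <ℝ y = ∃[ ε ] (0ℚ < ε × ∃[ M ] (∀ n → M ℕ.≤ n → seq x n + ε ≤ seq y n))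

fromℚ : ℚ → ℝ
fromℚ q = mkℝ (λ _ → q) λ ε 0<ε → 0 , λ _ _ _ _ →
  subst (λ z → ∣ z ∣ ≤ ε) (sym (ℚₚ.+-inverseʳ q)) (ℚₚ.<⇒≤ 0<ε)

fromℕ : ℕ → ℝ
fromℕ n = fromℚ (+ n / 1)

0ℝ : ℝ
0ℝ = fromℕ 0

infixl 6 _+ℝ_ _-ℝ_
infixl 7 _*ℝ_ _÷ℝ_[_]
infix  8 -ℝ_

_+ℝ_ : ℝ → ℝ → ℝ
mkℝ x cx +ℝ mkℝ y cy = mkℝ (λ n → x n + y n) λ ε 0<ε →
  let 0<ε/2  = 0<p*q (0<1/n 2) 0<ε
      Mx , hx = cx (½ * ε) 0<ε/2
      My , hy = cy (½ * ε) 0<ε/2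
  in Mx ℕ.⊔ My , λ m n M≤m M≤n →
    subst (∣ (x m + y m) - (x n + y n) ∣ ≤_)
      (trans (sym (ℚₚ.*-distribʳ-+ ε ½ ½)) (ℚₚ.*-identityˡ ε))
      (ℚₚ.≤-trans
        (subst (λ z → ∣ z ∣ ≤ ∣ x m - x n ∣ + ∣ y m - y n ∣)
          (solve 4 (λ a b c d → (a :- b) :+ (c :- d) := (a :+ c) :- (b :+ d)) refl (x m) (x n) (y m) (y n))
          (ℚₚ.∣p+q∣≤∣p∣+∣q∣ (x m - x n) (y m - y n)))
        (ℚₚ.+-mono-≤
          (hx m n (ℕₚ.m⊔n≤o⇒m≤o Mx My M≤m) (ℕₚ.m⊔n≤o⇒m≤o Mx My M≤n))
          (hy m n (ℕₚ.m⊔n≤o⇒n≤o Mx My M≤m) (ℕₚ.m⊔n≤o⇒n≤o Mx My M≤n))))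
  where open +-*-Solver

-ℝ_ : ℝ → ℝ
-ℝ mkℝ x cx = mkℝ (λ n → - x n) λ ε 0<ε →
  let M , h = cx ε 0<ε
  in M , λ m n M≤m M≤n → subst (_≤ ε)
    (trans (sym (ℚₚ.∣-p∣≡∣p∣ (x m - x n)))
      (cong ∣_∣ (solve 2 (λ a b → :- (a :- b) := (:- a) :- (:- b)) refl (x m) (x n))))
    (h m n M≤m M≤n)
  where open +-*-Solver

_-ℝ_ : ℝ → ℝ → ℝ
x -ℝ y = x +ℝ (-ℝ y)

∣_∣ℝ : ℝ → ℝ
∣ mkℝ x cx ∣ℝ = mkℝ (λ n → ∣ x n ∣) λ ε 0<ε →
  let M , h = cx ε 0<ε
  in M , λ m n M≤m M≤n → ℚₚ.≤-trans (∣∣p∣-∣q∣∣≤∣p-q∣ (x m) (x n)) (h m n M≤m M≤n)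

eventually-bounded : ∀ {s} → IsCauchy s →
  ∃[ B ] (0ℚ < B × ∃[ M ] (∀ n → M ℕ.≤ n → ∣ s n ∣ ≤ B))
eventually-bounded {s} cs =
  let M , h = cs 1ℚ (0<1/n 1)
  in ∣ s M ∣ + 1ℚ
   , ℚₚ.+-mono-≤-< (ℚₚ.0≤∣p∣ (s M)) (0<1/n 1)
   , M
   , λ n M≤n → ℚₚ.≤-trans (∣p∣≤∣q∣+∣p-q∣ (s n) (s M))
                 (ℚₚ.+-monoʳ-≤ ∣ s M ∣ (h n M M≤n ℕₚ.≤-refl))

*-cauchy : ∀ {x y} → IsCauchy x → IsCauchy y → IsCauchy (λ n → x n * y n)
*-cauchy {x} {y} cx cy ε 0<ε =
  let A , 0<A , K , ∣x∣≤A = eventually-bounded {x} cx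
      B , 0<B , L , ∣y∣≤B = eventually-bounded {y} cy
  in go A 0<A K ∣x∣≤A B 0<B L ∣y∣≤B
  where
  go : ∀ A → 0ℚ < A → ∀ K → (∀ n → K ℕ.≤ n → ∣ x n ∣ ≤ A) →
       ∀ B → 0ℚ < B → ∀ L → (∀ n → L ℕ.≤ n → ∣ y n ∣ ≤ B) →
       ∃[ M ] (∀ m n → M ℕ.≤ m → M ℕ.≤ n → ∣ x m * y m - x n * y n ∣ ≤ ε)
  go A 0<A K ∣x∣≤A B 0<B L ∣y∣≤B = M , bound
    where
    open +-*-Solver
    0<A+B : 0ℚ < A + B
    0<A+B = ℚₚ.+-mono-< 0<A 0<B
    instance
      A+B≢0 : ℚ.NonZero (A + B)
      A+B≢0 = ℚ.>-nonZero 0<A+B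
    δ : ℚ
    δ = 1/ (A + B) * ε
    0<δ : 0ℚ < δ
    0<δ = 0<p*q (0<1/p (A + B) 0<A+B) 0<ε
    hx = cx δ 0<δ
    hy = cy δ 0<δ
    M : ℕ
    M = (K ℕ.⊔ L) ℕ.⊔ (proj₁ hx ℕ.⊔ proj₁ hy)
    Aδ+Bδ≡ε : A * δ + B * δ ≡ ε
    Aδ+Bδ≡ε = begin
      A * δ + B * δ              ≡⟨ ℚₚ.*-distribʳ-+ δ A B ⟨
      (A + B) * (1/ (A + B) * ε) ≡⟨ ℚₚ.*-assoc (A + B) _ ε ⟨
      (A + B) * 1/ (A + B) * ε   ≡⟨ cong (_* ε) (ℚₚ.*-inverseʳ (A + B)) ⟩
      1ℚ * ε                     ≡⟨ ℚₚ.*-identityˡ ε ⟩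
      ε                          ∎
      where open ≡-Reasoning
    bound : ∀ m n → M ℕ.≤ m → M ℕ.≤ n → ∣ x m * y m - x n * y n ∣ ≤ ε
    bound m n M≤m M≤n = begin
      ∣ x m * y m - x n * y n ∣
        ≡⟨ cong ∣_∣ (solve 4 (λ a b c d → a :* b :- c :* d := a :* (b :- d) :+ d :* (a :- c))
             refl (x m) (y m) (x n) (y n)) ⟩
      ∣ x m * (y m - y n) + y n * (x m - x n) ∣
        ≤⟨ ℚₚ.∣p+q∣≤∣p∣+∣q∣ (x m * (y m - y n)) (y n * (x m - x n)) ⟩
      ∣ x m * (y m - y n) ∣ + ∣ y n * (x m - x n) ∣
        ≡⟨ cong₂ _+_ (ℚₚ.∣p*q∣≡∣p∣*∣q∣ (x m) (y m - y n)) (ℚₚ.∣p*q∣≡∣p∣*∣q∣ (y n) (x m - x n)) ⟩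
      ∣ x m ∣ * ∣ y m - y n ∣ + ∣ y n ∣ * ∣ x m - x n ∣
        ≤⟨ ℚₚ.+-mono-≤
             (*-mono-≤ (ℚₚ.0≤∣p∣ _) (ℚₚ.<⇒≤ 0<A) (∣x∣≤A m (ℕₚ.m⊔n≤o⇒m≤o K L (below M≤m)))
               (proj₂ hy m n (right M≤m) (right M≤n)))
             (*-mono-≤ (ℚₚ.0≤∣p∣ _) (ℚₚ.<⇒≤ 0<B) (∣y∣≤B n (ℕₚ.m⊔n≤o⇒n≤o K L (below M≤n)))
               (proj₂ hx m n (left M≤m) (left M≤n))) ⟩
      A * δ + B * δ
        ≡⟨ Aδ+Bδ≡ε ⟩
      ε ∎
      where
      open ℚₚ.≤-Reasoning
      below : ∀ {k} → M ℕ.≤ k → K ℕ.⊔ L ℕ.≤ k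
      below = ℕₚ.m⊔n≤o⇒m≤o (K ℕ.⊔ L) _
      left : ∀ {k} → M ℕ.≤ k → proj₁ hx ℕ.≤ k
      left M≤k = ℕₚ.m⊔n≤o⇒m≤o (proj₁ hx) (proj₁ hy) (ℕₚ.m⊔n≤o⇒n≤o (K ℕ.⊔ L) _ M≤k)
      right : ∀ {k} → M ℕ.≤ k → proj₁ hy ℕ.≤ k
      right M≤k = ℕₚ.m⊔n≤o⇒n≤o (proj₁ hx) (proj₁ hy) (ℕₚ.m⊔n≤o⇒n≤o (K ℕ.⊔ L) _ M≤k)

_*ℝ_ : ℝ → ℝ → ℝ
mkℝ x cx *ℝ mkℝ y cy = mkℝ (λ n → x n * y n) (*-cauchy {x} {y} cx cy)

0<*ℝ : ∀ x y → 0ℝ <ℝ x → 0ℝ <ℝ y → 0ℝ <ℝ x *ℝ y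
0<*ℝ x y (ε , 0<ε , K , ε≤x) (δ , 0<δ , L , δ≤y) =
  ε * δ , 0<p*q 0<ε 0<δ , K ℕ.⊔ L , λ n M≤n →
    let ε≤xn = subst (_≤ seq x n) (ℚₚ.+-identityˡ ε) (ε≤x n (ℕₚ.m⊔n≤o⇒m≤o K L M≤n))
        δ≤yn = subst (_≤ seq y n) (ℚₚ.+-identityˡ δ) (δ≤y n (ℕₚ.m⊔n≤o⇒n≤o K L M≤n))
    in subst (_≤ seq x n * seq y n) (sym (ℚₚ.+-identityˡ (ε * δ)))
         (*-mono-≤ (ℚₚ.<⇒≤ 0<δ) (ℚₚ.≤-trans (ℚₚ.<⇒≤ 0<ε) ε≤xn) ε≤xn δ≤yn)

0<fromℕ-suc : ∀ n → 0ℝ <ℝ fromℕ (suc n)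
0<fromℕ-suc n = 1ℚ , 0<1/n 1 , 0 , λ _ _ →
  subst (_≤ + suc n / 1) (sym (ℚₚ.+-identityˡ 1ℚ)) (/-mono-≤ 1 1 (suc n) 1 (s≤s z≤n))

-- If ε > 0 is the bound supplied by 0ℝ <ℝ x, then xₙ ⊔ ε is positive for every n
-- and equals xₙ for all large n, so 1/(xₙ ⊔ ε) represents 1/x.
module Reciprocal (x : ℝ) (0<x : 0ℝ <ℝ x) where
  ε : ℚ
  ε = proj₁ 0<x

  0<ε : 0ℚ < ε
  0<ε = proj₁ (proj₂ 0<x)

  y : ℕ → ℚ
  y n = seq x n ⊔ ε

  0<y : ∀ n → 0ℚ < y n
  0<y n = ℚₚ.<-≤-trans 0<ε (ℚₚ.p≤q⊔p (seq x n) ε)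

  ry : ℕ → ℚ
  ry n = (1/ y n) {{ℚ.>-nonZero (0<y n)}}

  y*ry : ∀ n → y n * ry n ≡ 1ℚ
  y*ry n = ℚₚ.*-inverseʳ (y n) {{ℚ.>-nonZero (0<y n)}}

  ry≥0 : ∀ n → 0ℚ ≤ ry n
  ry≥0 n = ℚₚ.<⇒≤ (0<1/p (y n) (0<y n))

  ε⁻¹ : ℚ
  ε⁻¹ = (1/ ε) {{ℚ.>-nonZero 0<ε}}

  0<ε⁻¹ : 0ℚ < ε⁻¹
  0<ε⁻¹ = 0<1/p ε 0<ε

  ry≤ε⁻¹ : ∀ n → ry n ≤ ε⁻¹
  ry≤ε⁻¹ n = begin
    ry n               ≡⟨ ℚₚ.*-identityˡ (ry n) ⟨
    1ℚ * ry n          ≡⟨ cong (_* ry n) (ℚₚ.*-inverseˡ ε {{ℚ.>-nonZero 0<ε}}) ⟨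
    ε⁻¹ * ε * ry n     ≡⟨ ℚₚ.*-assoc ε⁻¹ ε (ry n) ⟩
    ε⁻¹ * (ε * ry n)   ≤⟨ ℚₚ.*-monoˡ-≤-nonNeg ε⁻¹ {{ℚ.nonNegative (ℚₚ.<⇒≤ 0<ε⁻¹)}}
                            (ℚₚ.*-monoʳ-≤-nonNeg (ry n) {{ℚ.nonNegative (ry≥0 n)}}
                              (ℚₚ.p≤q⊔p (seq x n) ε)) ⟩
    ε⁻¹ * (y n * ry n) ≡⟨ cong (ε⁻¹ *_) (y*ry n) ⟩
    ε⁻¹ * 1ℚ           ≡⟨ ℚₚ.*-identityʳ ε⁻¹ ⟩
    ε⁻¹                ∎
    where open ℚₚ.≤-Reasoning

  ⊔-nonexpansive : ∀ m n → ∣ y m - y n ∣ ≤ ∣ seq x m - seq x n ∣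
  ⊔-nonexpansive m n = ∣p-q∣≤r (half m n)
    (subst (λ z → y n ≤ y m + z)
      (trans (sym (ℚₚ.∣-p∣≡∣p∣ _))
        (cong ∣_∣ (solve 2 (λ p q → :- (q :- p) := p :- q) refl (seq x m) (seq x n))))
      (half n m))
    where
    open +-*-Solver
    half : ∀ m n → y m ≤ y n + ∣ seq x m - seq x n ∣
    half m n = ℚₚ.⊔-lub
      (ℚₚ.≤-trans
        (subst (_≤ seq x n + ∣ seq x m - seq x n ∣)
          (solve 2 (λ p q → q :+ (p :- q) := p) refl (seq x m) (seq x n))
          (ℚₚ.+-monoʳ-≤ (seq x n) (p≤∣p∣ (seq x m - seq x n))))
        (ℚₚ.+-monoˡ-≤ ∣ seq x m - seq x n ∣ (ℚₚ.p≤p⊔q (seq x n) ε)))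
      (subst (_≤ y n + ∣ seq x m - seq x n ∣) (ℚₚ.+-identityʳ ε)
        (ℚₚ.+-mono-≤ (ℚₚ.p≤q⊔p (seq x n) ε) (ℚₚ.0≤∣p∣ (seq x m - seq x n))))

  difference : ∀ m n → ry m - ry n ≡ ry m * ry n * - (y m - y n)
  difference m n = begin
    ry m - ry n
      ≡⟨ cong₂ _-_ (ℚₚ.*-identityʳ (ry m)) (ℚₚ.*-identityʳ (ry n)) ⟨
    ry m * 1ℚ - ry n * 1ℚ
      ≡⟨ cong₂ (λ a b → ry m * a - ry n * b) (y*ry n) (y*ry m) ⟨
    ry m * (y n * ry n) - ry n * (y m * ry m)
      ≡⟨ solve 4 (λ a b c d → c :* (b :* d) :- d :* (a :* c) := c :* d :* :- (a :- b))
           refl (y m) (y n) (ry m) (ry n) ⟩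
    ry m * ry n * - (y m - y n) ∎
    where
    open ≡-Reasoning
    open +-*-Solver

  ry-cauchy : IsCauchy ry
  ry-cauchy η 0<η =
    let M , h = cauchy x (ε * ε * η) (0<p*q (0<p*q 0<ε 0<ε) 0<η)
    in M , λ m n M≤m M≤n → begin
      ∣ ry m - ry n ∣
        ≡⟨ cong ∣_∣ (difference m n) ⟩
      ∣ ry m * ry n * - (y m - y n) ∣
        ≡⟨ ℚₚ.∣p*q∣≡∣p∣*∣q∣ (ry m * ry n) (- (y m - y n)) ⟩
      ∣ ry m * ry n ∣ * ∣ - (y m - y n) ∣
        ≡⟨ cong₂ _*_ (ℚₚ.0≤p⇒∣p∣≡p (0≤ry*ry m n)) (ℚₚ.∣-p∣≡∣p∣ (y m - y n)) ⟩
      ry m * ry n * ∣ y m - y n ∣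
        ≤⟨ *-mono-≤ (ℚₚ.0≤∣p∣ (y m - y n)) (ℚₚ.<⇒≤ (0<p*q 0<ε⁻¹ 0<ε⁻¹))
             (*-mono-≤ (ry≥0 n) (ℚₚ.<⇒≤ 0<ε⁻¹) (ry≤ε⁻¹ m) (ry≤ε⁻¹ n))
             (ℚₚ.≤-trans (⊔-nonexpansive m n) (h m n M≤m M≤n)) ⟩
      ε⁻¹ * ε⁻¹ * (ε * ε * η)
        ≡⟨ solve 3 (λ a b c → a :* a :* (b :* b :* c) := a :* b :* (a :* b) :* c) refl ε⁻¹ ε η ⟩
      ε⁻¹ * ε * (ε⁻¹ * ε) * η
        ≡⟨ cong (λ z → z * z * η) (ℚₚ.*-inverseˡ ε {{ℚ.>-nonZero 0<ε}}) ⟩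
      1ℚ * 1ℚ * η
        ≡⟨ ℚₚ.*-identityˡ η ⟩
      η ∎
    where
    open ℚₚ.≤-Reasoning
    open +-*-Solver
    0≤ry*ry : ∀ m n → 0ℚ ≤ ry m * ry n
    0≤ry*ry m n = ℚₚ.<⇒≤ (0<p*q (0<1/p (y m) (0<y m)) (0<1/p (y n) (0<y n)))

  reciprocal : ℝ
  reciprocal = mkℝ ry ry-cauchy

_÷ℝ_[_] : (x y : ℝ) → 0ℝ <ℝ y → ℝ
x ÷ℝ y [ 0<y ] = x *ℝ Reciprocal.reciprocal y 0<y

cauchy-criterion : ∀ {s} → (∀ m n → s m ≤ s n + + 1 / suc n) → IsCauchy s
cauchy-criterion {s} h ε 0<ε =
  let M , 1/n≤ = 1/n≤ε 0<ε
  in M , λ m n M≤m M≤n → ∣p-q∣≤r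
       (ℚₚ.≤-trans (h m n) (ℚₚ.+-monoʳ-≤ (s n) (1/n≤ n M≤n)))
       (ℚₚ.≤-trans (h n m) (ℚₚ.+-monoʳ-≤ (s m) (1/n≤ m M≤m)))

module Zeta (s : ℕ) (2≤s : 2 ℕ.≤ s) where
  term : ℕ → ℚ
  term i = (+ 1 / (suc i ℕ.^ s)) {{ℕₚ.m^n≢0 (suc i) s}}

  partial : ℕ → ℚ
  partial n = ∑ n term

  0≤term : ∀ i → 0ℚ ≤ term i
  0≤term i = 0≤a/b 1 (suc i ℕ.^ s) {{ℕₚ.m^n≢0 (suc i) s}}

  telescope : ∀ i → term (suc i) + + 1 / suc (suc i) ≤ + 1 / suc i
  telescope i = begin
    term (suc i) + + 1 / k
      ≤⟨ ℚₚ.+-monoˡ-≤ (+ 1 / k) (1/-anti-≤ (k ℕ.* j) (k ℕ.^ s) {{_}} {{ℕₚ.m^n≢0 k s}} kj≤kˢ) ⟩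
    + 1 / (k ℕ.* j) + + 1 / k
      ≡⟨ /-+-/ 1 (k ℕ.* j) 1 k ⟩
    + (1 ℕ.* k ℕ.+ 1 ℕ.* (k ℕ.* j)) / (k ℕ.* j ℕ.* k)
      ≤⟨ /-mono-≤ (1 ℕ.* k ℕ.+ 1 ℕ.* (k ℕ.* j)) (k ℕ.* j ℕ.* k) 1 j (ℕₚ.≤-reflexive eq) ⟩
    + 1 / j ∎
    where
    open ℚₚ.≤-Reasoning
    j k : ℕ
    j = suc i
    k = suc j
    kj≤kˢ : k ℕ.* j ℕ.≤ k ℕ.^ s
    kj≤kˢ = ℕₚ.≤-trans
      (ℕₚ.*-monoʳ-≤ k (ℕₚ.≤-trans (ℕₚ.n≤1+n j) (ℕₚ.≤-reflexive (sym (ℕₚ.*-identityʳ k)))))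
      (ℕₚ.^-monoʳ-≤ k 2≤s)
    eq : (1 ℕ.* k ℕ.+ 1 ℕ.* (k ℕ.* j)) ℕ.* j ≡ 1 ℕ.* (k ℕ.* j ℕ.* k)
    eq = solve 1 (λ j → let k = con 1 :+ j in
      (con 1 :* k :+ con 1 :* (k :* j)) :* j := con 1 :* (k :* j :* k)) refl j
      where open ℕ-+-*-Solver

  partial-mono : ∀ k d → partial k ≤ partial (d ℕ.+ k)
  partial-mono k zero    = ℚₚ.≤-refl
  partial-mono k (suc d) = ℚₚ.≤-trans (partial-mono k d)
    (subst (_≤ partial (d ℕ.+ k) + term (d ℕ.+ k)) (ℚₚ.+-identityʳ _)
      (ℚₚ.+-monoʳ-≤ (partial (d ℕ.+ k)) (0≤term (d ℕ.+ k))))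

  tail : ∀ n d → partial (suc (d ℕ.+ n)) + + 1 / suc (d ℕ.+ n) ≤ partial (suc n) + + 1 / suc n
  tail n zero    = ℚₚ.≤-refl
  tail n (suc d) = ℚₚ.≤-trans
    (subst (_≤ partial (suc (d ℕ.+ n)) + + 1 / suc (d ℕ.+ n))
      (sym (ℚₚ.+-assoc (partial (suc (d ℕ.+ n))) (term (suc (d ℕ.+ n))) (+ 1 / suc (suc (d ℕ.+ n)))))
      (ℚₚ.+-monoʳ-≤ (partial (suc (d ℕ.+ n))) (telescope (d ℕ.+ n))))
    (tail n d)

  bound : ∀ m n → partial (suc m) ≤ partial (suc n) + + 1 / suc n
  bound m n with ℕₚ.≤-total m n
  ... | inj₁ m≤n = ℚₚ.≤-trans
    (subst (λ z → partial (suc m) ≤ partial z)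
      (trans (ℕₚ.+-suc (n ℕ.∸ m) m) (cong suc (ℕₚ.m∸n+n≡m m≤n)))
      (partial-mono (suc m) (n ℕ.∸ m)))
    (p≤p+1/k (partial (suc n)) n)
    where
    p≤p+1/k : ∀ p k → p ≤ p + + 1 / suc k
    p≤p+1/k p k = subst (_≤ p + + 1 / suc k) (ℚₚ.+-identityʳ p)
      (ℚₚ.+-monoʳ-≤ p (0≤a/b 1 (suc k)))
  ... | inj₂ n≤m = ℚₚ.≤-trans
    (subst (_≤ partial (suc m) + + 1 / suc m) (ℚₚ.+-identityʳ _)
      (ℚₚ.+-monoʳ-≤ (partial (suc m)) (0≤a/b 1 (suc m))))
    (subst (λ z → partial (suc z) + + 1 / suc z ≤ partial (suc n) + + 1 / suc n)
      (ℕₚ.m∸n+n≡m n≤m) (tail n (m ℕ.∸ n)))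

ζ : (s : ℕ) → 2 ℕ.≤ s → ℝ
ζ s 2≤s = mkℝ (λ n → Zeta.partial s 2≤s (suc n)) (cauchy-criterion (Zeta.bound s 2≤s))

0<ζ : ∀ s 2≤s → 0ℝ <ℝ ζ s 2≤s
0<ζ s 2≤s = partial 1 , 0<partial1 , 0 , λ n _ →
  subst₂ _≤_ (sym (ℚₚ.+-identityˡ (partial 1))) (cong partial (ℕₚ.+-comm n 1)) (partial-mono 1 n)
  where
  open Zeta s 2≤s
  0<partial1 : 0ℚ < partial 1
  0<partial1 = subst (0ℚ <_) (sym (ℚₚ.+-identityˡ (term 0)))
    (0<1/n (1 ℕ.^ s) {{ℕₚ.m^n≢0 1 s}})

∑-mono : ∀ n {f g} → (∀ i → i ℕ.< n → f i ≤ g i) → ∑ n f ≤ ∑ n g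
∑-mono zero    h = ℚₚ.≤-refl
∑-mono (suc n) h = ℚₚ.+-mono-≤ (∑-mono n (λ i i<n → h i (ℕₚ.m<n⇒m<1+n i<n))) (h n ℕₚ.≤-refl)

∑-cong : ∀ n {f g} → (∀ i → f i ≡ g i) → ∑ n f ≡ ∑ n g
∑-cong zero    h = refl
∑-cong (suc n) h = cong₂ _+_ (∑-cong n h) (h n)

∑-+ : ∀ m n f → ∑ (n ℕ.+ m) f ≡ ∑ m f + ∑ n (λ i → f (i ℕ.+ m))
∑-+ m zero    f = sym (ℚₚ.+-identityʳ (∑ m f))
∑-+ m (suc n) f = trans (cong (_+ f (n ℕ.+ m)) (∑-+ m n f)) (ℚₚ.+-assoc (∑ m f) _ _)

∑-blocks : ∀ a m f → ∑ (a ℕ.* m) f ≡ ∑ a (λ i → ∑ m (λ r → f (r ℕ.+ i ℕ.* m)))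
∑-blocks zero    m f = refl
∑-blocks (suc a) m f = trans (∑-+ (a ℕ.* m) m f)
  (cong (_+ ∑ m (λ r → f (r ℕ.+ a ℕ.* m))) (∑-blocks a m f))

∑-const : ∀ m j .{{_ : ℕ.NonZero j}} → ∑ m (λ _ → + 1 / j) ≡ + m / j
∑-const zero    j = sym (ℚₚ.0/n≡0 j)
∑-const (suc m) j@(suc _) = trans (cong (_+ + 1 / j) (∑-const m j))
  (trans (/-+-/ m j 1 j) (ℚₚ.≤-antisym
    (/-mono-≤ (m ℕ.* j ℕ.+ 1 ℕ.* j) (j ℕ.* j) (suc m) j (ℕₚ.≤-reflexive eq))
    (/-mono-≤ (suc m) j (m ℕ.* j ℕ.+ 1 ℕ.* j) (j ℕ.* j) (ℕₚ.≤-reflexive (sym eq)))))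
  where
  eq : (m ℕ.* j ℕ.+ 1 ℕ.* j) ℕ.* j ≡ suc m ℕ.* (j ℕ.* j)
  eq = trans (cong (ℕ._* j) (trans (sym (ℕₚ.*-distribʳ-+ j m 1)) (cong (ℕ._* j) (ℕₚ.+-comm m 1))))
    (ℕₚ.*-assoc (suc m) j j)

∑-shift : ∀ n f → ∑ n (λ i → f (suc i)) + f 0 ≡ ∑ n f + f n
∑-shift zero    f = refl
∑-shift (suc n) f = begin
  ∑ n (λ i → f (suc i)) + f (suc n) + f 0
    ≡⟨ solve 3 (λ a b c → a :+ b :+ c := a :+ c :+ b) refl (∑ n (λ i → f (suc i))) (f (suc n)) (f 0) ⟩
  ∑ n (λ i → f (suc i)) + f 0 + f (suc n)
    ≡⟨ cong (_+ f (suc n)) (∑-shift n f) ⟩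
  ∑ n f + f n + f (suc n) ∎
  where
  open ≡-Reasoning
  open +-*-Solver

-- Riemann sums of ∫₁ᴺ dt/t for the partition of [1,N] into intervals of length 1/k:
-- with j running over the right (left) endpoints t = j/k, the summand is (1/k)·1/(j/k) = 1/j.
module Log (N : ℕ) where
  right left : (k : ℕ) .{{_ : ℕ.NonZero k}} → ℚ
  right k         = ∑ ((N ℕ.∸ 1) ℕ.* k) (λ i → + 1 / suc (i ℕ.+ k))
  left  k@(suc l) = ∑ ((N ℕ.∸ 1) ℕ.* k) (λ i → + 1 / suc (i ℕ.+ l))

  right≤left : ∀ k .{{_ : ℕ.NonZero k}} → right k ≤ left k
  right≤left k@(suc l) = ∑-mono ((N ℕ.∸ 1) ℕ.* k) λ i _ →
    1/-anti-≤ (suc (i ℕ.+ l)) (suc (i ℕ.+ k)) (s≤s (ℕₚ.+-monoʳ-≤ i (ℕₚ.n≤1+n l)))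

  left≤right+1/k : ∀ k .{{_ : ℕ.NonZero k}} → left k ≤ right k + + 1 / k
  left≤right+1/k k@(suc l) = begin
    left k            ≡⟨ ℚₚ.+-identityʳ (left k) ⟨
    left k + 0ℚ       ≤⟨ ℚₚ.+-monoʳ-≤ (left k) (0≤a/b 1 (suc (n ℕ.+ l))) ⟩
    left k + f n      ≡⟨ ∑-shift n f ⟨
    ∑ n (λ i → f (suc i)) + f 0
                      ≡⟨ cong (_+ f 0) (∑-cong n (λ i →
                           ℚₚ./-cong {+ 1} {_} {+ 1} refl (cong suc (sym (ℕₚ.+-suc i l))))) ⟩
    right k + + 1 / k ∎
    where
    open ℚₚ.≤-Reasoning
    n : ℕ
    n = (N ℕ.∸ 1) ℕ.* k
    f : ℕ → ℚ
    f i = + 1 / suc (i ℕ.+ l)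

  private
    split : ∀ k m f → ∑ ((N ℕ.∸ 1) ℕ.* (k ℕ.* m)) f ≡
            ∑ ((N ℕ.∸ 1) ℕ.* k) (λ i → ∑ m (λ r → f (r ℕ.+ i ℕ.* m)))
    split k m f = trans (cong (λ z → ∑ z f) (sym (ℕₚ.*-assoc (N ℕ.∸ 1) k m)))
      (∑-blocks ((N ℕ.∸ 1) ℕ.* k) m f)

    m/jm : ∀ m j .{{_ : ℕ.NonZero j}} .{{_ : ℕ.NonZero (j ℕ.* m)}} → + m / (j ℕ.* m) ≡ + 1 / j
    m/jm m j = ℚₚ.≤-antisym
      (/-mono-≤ m (j ℕ.* m) 1 j (ℕₚ.≤-reflexive eq))
      (/-mono-≤ 1 j m (j ℕ.* m) (ℕₚ.≤-reflexive (sym eq)))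
      where
      eq : m ℕ.* j ≡ 1 ℕ.* (j ℕ.* m)
      eq = trans (ℕₚ.*-comm m j) (sym (ℕₚ.*-identityˡ (j ℕ.* m)))

    regroup : ∀ r i k m → r ℕ.+ i ℕ.* m ℕ.+ k ℕ.* m ≡ r ℕ.+ (i ℕ.+ k) ℕ.* m
    regroup r i k m = trans (ℕₚ.+-assoc r (i ℕ.* m) (k ℕ.* m))
      (cong (r ℕ.+_) (sym (ℕₚ.*-distribʳ-+ m i k)))

  right-refine : ∀ k m .{{_ : ℕ.NonZero k}} .{{_ : ℕ.NonZero m}} .{{_ : ℕ.NonZero (k ℕ.* m)}} →
                 right k ≤ right (k ℕ.* m)
  right-refine k m@(suc _) = subst (right k ≤_) (sym (split k m _))
    (∑-mono ((N ℕ.∸ 1) ℕ.* k) λ i _ → begin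
      + 1 / suc (i ℕ.+ k)
        ≡⟨ m/jm m (suc (i ℕ.+ k)) ⟨
      + m / (suc (i ℕ.+ k) ℕ.* m)
        ≡⟨ ∑-const m (suc (i ℕ.+ k) ℕ.* m) ⟨
      ∑ m (λ _ → + 1 / (suc (i ℕ.+ k) ℕ.* m))
        ≤⟨ ∑-mono m (λ r r<m → 1/-anti-≤ (suc (r ℕ.+ i ℕ.* m ℕ.+ k ℕ.* m)) (suc (i ℕ.+ k) ℕ.* m)
             (subst (ℕ._≤ suc (i ℕ.+ k) ℕ.* m) (cong suc (sym (regroup r i k m)))
               (ℕₚ.+-monoˡ-≤ ((i ℕ.+ k) ℕ.* m) r<m))) ⟩
      ∑ m (λ r → + 1 / suc (r ℕ.+ i ℕ.* m ℕ.+ k ℕ.* m)) ∎)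
    where open ℚₚ.≤-Reasoning

  left-refine : ∀ k m .{{_ : ℕ.NonZero k}} .{{_ : ℕ.NonZero m}} .{{_ : ℕ.NonZero (k ℕ.* m)}} →
                left (k ℕ.* m) ≤ left k
  left-refine k@(suc l) m@(suc m′) = subst (_≤ left k) (sym (split k m _))
    (∑-mono ((N ℕ.∸ 1) ℕ.* k) λ i _ → begin
      ∑ m (λ r → + 1 / suc (r ℕ.+ i ℕ.* m ℕ.+ (m′ ℕ.+ l ℕ.* m)))
        ≤⟨ ∑-mono m (λ r _ → 1/-anti-≤ (suc (i ℕ.+ l) ℕ.* m)
             (suc (r ℕ.+ i ℕ.* m ℕ.+ (m′ ℕ.+ l ℕ.* m))) (le i r)) ⟩
      ∑ m (λ _ → + 1 / (suc (i ℕ.+ l) ℕ.* m))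
        ≡⟨ ∑-const m (suc (i ℕ.+ l) ℕ.* m) ⟩
      + m / (suc (i ℕ.+ l) ℕ.* m)
        ≡⟨ m/jm m (suc (i ℕ.+ l)) ⟩
      + 1 / suc (i ℕ.+ l) ∎)
    where
    open ℚₚ.≤-Reasoning
    le : ∀ i r → suc (i ℕ.+ l) ℕ.* m ℕ.≤ suc (r ℕ.+ i ℕ.* m ℕ.+ (m′ ℕ.+ l ℕ.* m))
    le i r = subst₂ ℕ._≤_
      (cong (ℕ._* m) (ℕₚ.+-suc i l))
      (trans (sym (regroup r i k m)) (ℕₚ.+-suc (r ℕ.+ i ℕ.* m) (m′ ℕ.+ l ℕ.* m)))
      (ℕₚ.m≤n+m ((i ℕ.+ k) ℕ.* m) r)

  right≤left′ : ∀ k m .{{_ : ℕ.NonZero k}} .{{_ : ℕ.NonZero m}} → right k ≤ left m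
  right≤left′ k@(suc _) m@(suc _) = begin
    right k          ≤⟨ right-refine k m ⟩
    right (k ℕ.* m)  ≤⟨ right≤left (k ℕ.* m) ⟩
    left (k ℕ.* m)   ≡⟨ left-cong (ℕₚ.*-comm k m) ⟩
    left (m ℕ.* k)   ≤⟨ left-refine m k ⟩
    left m           ∎
    where
    open ℚₚ.≤-Reasoning
    left-cong : ∀ {a b} .{{_ : ℕ.NonZero a}} .{{_ : ℕ.NonZero b}} → a ≡ b → left a ≡ left b
    left-cong refl = refl

  bound : ∀ m n → right (suc m) ≤ right (suc n) + + 1 / suc n
  bound m n = ℚₚ.≤-trans (right≤left′ (suc m) (suc n)) (left≤right+1/k (suc n))

-- log N = ∫₁ᴺ dt/t for N ≥ 1; the value at N = 0 is meaningless (it is 0).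
log : ℕ → ℝ
log N = mkℝ (λ n → Log.right N (suc n)) (cauchy-criterion (Log.bound N))

0<log : ∀ {N} → 2 ℕ.≤ N → 0ℝ <ℝ log N
0<log {N@(suc (suc M))} (s≤s (s≤s z≤n)) = ½ , 0<1/n 2 , 0 , λ n _ →
  subst (_≤ right (suc n)) (sym (ℚₚ.+-identityˡ ½))
    (ℚₚ.≤-trans ½≤right1
      (subst (right 1 ≤_) (right-cong (ℕₚ.*-identityˡ (suc n))) (right-refine 1 (suc n))))
  where
  open Log N
  right-cong : ∀ {a b} .{{_ : ℕ.NonZero a}} .{{_ : ℕ.NonZero b}} → a ≡ b → right a ≡ right b
  right-cong refl = refl
  f : ℕ → ℚ
  f i = + 1 / suc (i ℕ.+ 1)
  ½≤∑ : ∀ d → ½ ≤ ∑ (suc d) f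
  ½≤∑ zero    = ℚₚ.≤-reflexive (sym (ℚₚ.+-identityˡ ½))
  ½≤∑ (suc d) = ℚₚ.≤-trans (½≤∑ d)
    (subst (_≤ ∑ (suc d) f + f (suc d)) (ℚₚ.+-identityʳ (∑ (suc d) f))
      (ℚₚ.+-monoʳ-≤ (∑ (suc d) f) (0≤a/b 1 (suc (suc d ℕ.+ 1)))))
  ½≤right1 : ½ ≤ right 1
  ½≤right1 = ½≤∑ (M ℕ.* 1)

{-# OPTIONS --safe #-}

-- Let T(n) = ∑ₖ φ(k) · #{(h, m) : h, m ≤ n, gcd(h, m) = 1, hk ≤ m}, which differs from
-- ∑ₖ φ(k) I_n(1/k) by at most n².  Every pair (h, m) is uniquely a multiple d · (h′, m′) of
-- a coprime pair and hk ≤ m is homogeneous, so ∑_{d≤n} T(⌊n/d⌋) drops the coprimality condition;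
-- a second use of the same principle gives ∑ₖ φ(k)⌊m/k⌋ = m(m+1)/2 and hence the exact identity
--   6 ∑_{d≤n} T(⌊n/d⌋) = n(n+1)(n+2).
-- Since ζ(3) n³ = ∑_d ⌊n/d⌋³ + O(n²), the error E(n) = 6ζ(3)T(n) − n³ satisfies
-- ∑_{d≤n} E(⌊n/d⌋) = O(n²), and since ∑_{d≥2} 1/d² ≤ 3/4 < 1, strong induction gives E(n) = O(n²).
-- This is stronger than required because log N ≤ N.
module Submission where

open import Defs
open import Data.Nat using (ℕ; suc; _≤_; _*_; _^_; z≤n; s≤s)
open import Data.Integer using (+_)
open import Data.Rational using (_/_)
open import Data.Fin using (Fin; toℕ)
open import Data.List using (sum; tabulate)
open import Data.Product using (∃-syntax)

open import Data.Bool using (if_then_else_)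
open import Data.Empty using (⊥-elim)
open import Data.Integer as ℤ using ()
import Data.Integer.Properties as ℤₚ
open import Data.List using (List; []; _∷_; _++_; length; map; filter; concatMap; applyUpTo; upTo)
open import Data.List.Membership.Propositional using (_∈_)
open import Data.List.Properties using (filter-++; filter-none; length-++; length-filter; length-upTo)
open import Data.List.Relation.Binary.Permutation.Propositional.Properties using (filter-↭; ↭-length)
open import Data.List.Relation.Unary.All as All using ()
open import Data.List.Relation.Unary.AllPairs using (AllPairs; _∷_)
open import Data.List.Relation.Unary.Any using (index; here; there)
open import Data.List.Relation.Unary.Linked.Properties using (Linked⇒AllPairs)
open import Data.Nat as ℕ using (zero; _+_; _<_; _≟_; _≤?_)
open import Data.Nat.Divisibility using (_∣_; divides; ∣-refl; ∣1⇒≡1)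
open import Data.Nat.DivMod
  using (m/n*n≤m; m/n≤m; m/n<m; n/1≡n; m≡m%n+[m/n]*n; m%n<n; m<n⇒m/n≡0) renaming (_/_ to _div_)
open import Data.Nat.GCD
  using (gcd; gcd[m,n]∣m; gcd[m,n]∣n; gcd[m,n]≤n; gcd[m,n]≡0⇒m≡0; c*gcd[m,n]≡gcd[cm,cn]; gcd-greatest; gcd-identityˡ)
open import Data.Nat.Induction using (<-rec)
import Data.Nat.Properties as ℕₚ
open import Data.Nat.Solver renaming (module +-*-Solver to ℕ-Solver)
open import Data.Product using (_×_; _,_; proj₁; proj₂)
open import Data.Rational as ℚ using (ℚ; 0ℚ; 1ℚ)
import Data.Rational.Properties as ℚₚ
open import Data.Rational.Solver renaming (module +-*-Solver to ℚ-Solver)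
import Data.Rational.Unnormalised as ℚᵘ
import Data.Rational.Unnormalised.Properties as ℚᵘₚ
open import Data.List.Sort ℚₚ.≤-decTotalOrder using (sort-↭; sort-↗)
open import Data.Sum using (_⊎_; inj₁; inj₂)
open import Relation.Binary.PropositionalEquality
open import Relation.Nullary using (Dec; yes; no; ¬_; does)
open import Relation.Nullary.Decidable using (from-yes)
open import Relation.Unary using (Decidable)

-- Iverson brackets and finite sums of natural numbers.

⟦_⟧ : ∀ {p} {P : Set p} → Dec P → ℕ
⟦ P? ⟧ = if does P? then 1 else 0

⟦⟧-yes : ∀ {p} {P : Set p} (P? : Dec P) → P → ⟦ P? ⟧ ≡ 1
⟦⟧-yes (yes _) _ = refl
⟦⟧-yes (no ¬p) p = ⊥-elim (¬p p)

⟦⟧-no : ∀ {p} {P : Set p} (P? : Dec P) → ¬ P → ⟦ P? ⟧ ≡ 0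
⟦⟧-no (yes p) ¬p = ⊥-elim (¬p p)
⟦⟧-no (no _)  _  = refl

⟦⟧-mono : ∀ {p q} {P : Set p} {Q : Set q} (P? : Dec P) (Q? : Dec Q) → (P → Q) → ⟦ P? ⟧ ≤ ⟦ Q? ⟧
⟦⟧-mono (yes p) Q? f = ℕₚ.≤-reflexive (sym (⟦⟧-yes Q? (f p)))
⟦⟧-mono (no _)  Q? f = z≤n

⟦⟧-cong : ∀ {p q} {P : Set p} {Q : Set q} (P? : Dec P) (Q? : Dec Q) →
          (P → Q) → (Q → P) → ⟦ P? ⟧ ≡ ⟦ Q? ⟧
⟦⟧-cong P? Q? f g = ℕₚ.≤-antisym (⟦⟧-mono P? Q? f) (⟦⟧-mono Q? P? g)

∑ℕ : ℕ → (ℕ → ℕ) → ℕ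
∑ℕ zero    f = 0
∑ℕ (suc n) f = ∑ℕ n f + f n

∑ℕ-cong : ∀ n {f g} → (∀ i → i < n → f i ≡ g i) → ∑ℕ n f ≡ ∑ℕ n g
∑ℕ-cong zero    h = refl
∑ℕ-cong (suc n) h =
  cong₂ _+_ (∑ℕ-cong n (λ i i<n → h i (ℕₚ.m<n⇒m<1+n i<n))) (h n ℕₚ.≤-refl)

∑ℕ-mono : ∀ n {f g} → (∀ i → i < n → f i ≤ g i) → ∑ℕ n f ≤ ∑ℕ n g
∑ℕ-mono zero    h = z≤n
∑ℕ-mono (suc n) h =
  ℕₚ.+-mono-≤ (∑ℕ-mono n (λ i i<n → h i (ℕₚ.m<n⇒m<1+n i<n))) (h n ℕₚ.≤-refl)

∑ℕ-+ : ∀ n f g → ∑ℕ n (λ i → f i + g i) ≡ ∑ℕ n f + ∑ℕ n g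
∑ℕ-+ zero    f g = refl
∑ℕ-+ (suc n) f g = trans (cong (_+ (f n + g n)) (∑ℕ-+ n f g))
  (solve 4 (λ a b c d → (a :+ b) :+ (c :+ d) := (a :+ c) :+ (b :+ d)) refl (∑ℕ n f) (∑ℕ n g) (f n) (g n))
  where open ℕ-Solver

∑ℕ-*ˡ : ∀ n c f → ∑ℕ n (λ i → c * f i) ≡ c * ∑ℕ n f
∑ℕ-*ˡ zero    c f = sym (ℕₚ.*-zeroʳ c)
∑ℕ-*ˡ (suc n) c f = trans (cong (_+ c * f n) (∑ℕ-*ˡ n c f)) (sym (ℕₚ.*-distribˡ-+ c (∑ℕ n f) (f n)))

∑ℕ-0 : ∀ n → ∑ℕ n (λ _ → 0) ≡ 0
∑ℕ-0 zero    = refl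
∑ℕ-0 (suc n) = trans (ℕₚ.+-identityʳ _) (∑ℕ-0 n)

∑ℕ-const : ∀ n c → ∑ℕ n (λ _ → c) ≡ n * c
∑ℕ-const zero    c = refl
∑ℕ-const (suc n) c = trans (cong (_+ c) (∑ℕ-const n c)) (ℕₚ.+-comm (n * c) c)

∑ℕ-swap : ∀ m n (f : ℕ → ℕ → ℕ) → ∑ℕ m (λ i → ∑ℕ n (f i)) ≡ ∑ℕ n (λ j → ∑ℕ m (λ i → f i j))
∑ℕ-swap zero    n f = sym (∑ℕ-0 n)
∑ℕ-swap (suc m) n f = trans (cong (_+ ∑ℕ n (f m)) (∑ℕ-swap m n f))
  (sym (∑ℕ-+ n (λ j → ∑ℕ m (λ i → f i j)) (f m)))

∑ℕ-split-first : ∀ n f → ∑ℕ (suc n) f ≡ f 0 + ∑ℕ n (λ i → f (suc i))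
∑ℕ-split-first zero    f = ℕₚ.+-comm 0 (f 0)
∑ℕ-split-first (suc n) f = trans (cong (_+ f (suc n)) (∑ℕ-split-first n f))
  (ℕₚ.+-assoc (f 0) (∑ℕ n (λ i → f (suc i))) (f (suc n)))

∑ℕ-truncate : ∀ {m n} f → m ≤ n → (∀ i → m ≤ i → i < n → f i ≡ 0) → ∑ℕ n f ≡ ∑ℕ m f
∑ℕ-truncate {m} {zero}  f z≤n h = refl
∑ℕ-truncate {m} {suc n} f m≤1+n h with ℕₚ.m≤n⇒m<n∨m≡n m≤1+n
... | inj₂ refl       = refl
... | inj₁ (s≤s m≤n) = trans
  (cong₂ _+_ (∑ℕ-truncate f m≤n (λ i m≤i i<n → h i m≤i (ℕₚ.m<n⇒m<1+n i<n))) (h n m≤n ℕₚ.≤-refl))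
  (ℕₚ.+-identityʳ _)

∑ℕ-δ : ∀ {a} n (f : ℕ → ℕ) → a < n → ∑ℕ n (λ i → ⟦ a ≟ i ⟧ * f i) ≡ f a
∑ℕ-δ {a} n f a<n = begin
  ∑ℕ n g                 ≡⟨ ∑ℕ-truncate g a<n (λ i a<i _ → cong (_* f i) (⟦⟧-no (a ≟ i) (ℕₚ.<⇒≢ a<i))) ⟩
  ∑ℕ a g + ⟦ a ≟ a ⟧ * f a ≡⟨ cong₂ _+_ (∑ℕ-truncate {0} g z≤n (λ i _ i<a →
                                         cong (_* f i) (⟦⟧-no (a ≟ i) (ℕₚ.>⇒≢ i<a))))
                                       (cong (_* f a) (⟦⟧-yes (a ≟ a) refl)) ⟩
  1 * f a                ≡⟨ ℕₚ.*-identityˡ (f a) ⟩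
  f a                    ∎
  where
  open ≡-Reasoning
  g : ℕ → ℕ
  g i = ⟦ a ≟ i ⟧ * f i

-- For `a` outside the range every summand vanishes, which is why only an inequality remains.
∑ℕ-δ≤ : ∀ a n (f : ℕ → ℕ) → ∑ℕ n (λ i → ⟦ a ≟ i ⟧ * f i) ≤ f a
∑ℕ-δ≤ a n f with ℕₚ.<-≤-connex a n
... | inj₁ a<n = ℕₚ.≤-reflexive (∑ℕ-δ n f a<n)
... | inj₂ n≤a = subst (_≤ f a) (sym (∑ℕ-truncate {0} {n} _ z≤n λ i _ i<n →
  cong (_* f i) (⟦⟧-no (a ≟ i) (ℕₚ.>⇒≢ (ℕₚ.<-≤-trans i<n n≤a))))) z≤n

-- Sums over multiples, and pairs sorted by their gcd.

-- Summation indices start at 0 while the numbers meant start at 1: the two bounds place `suc i`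
-- strictly between `q * suc e` and `suc q * suc e`.
between-multiples : ∀ e q {i} → q * suc e ≤ i → i < e + q * suc e → ¬ suc e ∣ suc i
between-multiples e q {i} qd≤i i<e+qd (divides k 1+i≡kd) = ℕₚ.<⇒≱
  (ℕₚ.*-cancelʳ-< (suc e) q k (subst (q * suc e <_) 1+i≡kd (s≤s qd≤i)))
  (ℕₚ.≤-pred (ℕₚ.*-cancelʳ-< (suc e) k (suc q) (subst (_< suc q * suc e) 1+i≡kd (s≤s i<e+qd))))

-- Cut the range into blocks of length `suc e`: in each block only the last number is a multiple,
-- and the incomplete block at the end contains none.
∑ℕ-multiples : ∀ n e (g : ℕ → ℕ) → (∀ b → ¬ suc e ∣ suc b → g (suc b) ≡ 0) →
               ∑ℕ n (λ b → g (suc b)) ≡ ∑ℕ (n div suc e) (λ a → g (suc a * suc e))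
∑ℕ-multiples n e g g≡0 = trans
  (∑ℕ-truncate _ (m/n*n≤m n d) (λ i qd≤i i<n →
    g≡0 i (between-multiples e (n div d) qd≤i (ℕₚ.<-≤-trans i<n n≤e+qd))))
  (blocks (n div d))
  where
  d : ℕ
  d = suc e
  n≤e+qd : n ≤ e + n div d * d
  n≤e+qd = subst (_≤ e + n div d * d) (sym (m≡m%n+[m/n]*n n d))
    (ℕₚ.+-monoˡ-≤ (n div d * d) (ℕₚ.≤-pred (m%n<n n d)))
  blocks : ∀ q → ∑ℕ (q * d) (λ b → g (suc b)) ≡ ∑ℕ q (λ a → g (suc a * d))
  blocks zero    = refl
  -- `suc q * d` computes to `suc (e + q * d)`, so the last summand is the one at the multiple and
  -- the `e` summands before it vanish.
  blocks (suc q) = cong (_+ g (suc q * d)) (trans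
    (∑ℕ-truncate _ (ℕₚ.m≤n+m (q * d) e) (λ i qd≤i i<e+qd → g≡0 i (between-multiples e q qd≤i i<e+qd)))
    (blocks q))

-- h/m ≤ 1/c is written h · c ≤ m.
pairs coprimePairs : ℕ → ℕ → ℕ
pairs        c n = ∑ℕ n λ m → ∑ℕ n λ h → ⟦ suc h * c ≤? suc m ⟧
coprimePairs c n = ∑ℕ n λ m → ∑ℕ n λ h → ⟦ gcd (suc h) (suc m) ≟ 1 ⟧ * ⟦ suc h * c ≤? suc m ⟧

-- The gcd divides `suc m`, so it is one of the values 1, ..., n and exactly one bracket is 1.
∑-gcd≡1 : ∀ n {h m} → m < n → ∑ℕ n (λ e → ⟦ gcd (suc h) (suc m) ≟ suc e ⟧) ≡ 1
∑-gcd≡1 n {h} {m} m<n with gcd (suc h) (suc m) in eq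
... | zero  with () ← gcd[m,n]≡0⇒m≡0 {suc h} {suc m} eq
... | suc g = trans
  (∑ℕ-cong n (λ e _ → trans
    (⟦⟧-cong (suc g ≟ suc e) (g ≟ e) ℕₚ.suc-injective (cong suc)) (sym (ℕₚ.*-identityʳ _))))
  (∑ℕ-δ n (λ _ → 1) (ℕₚ.<-≤-trans (subst (_≤ suc m) eq (gcd[m,n]≤n (suc h) (suc m))) m<n))

-- Each pair receives the weight 1 in the form of `∑-gcd≡1`, the sum over the gcd is moved outside,
-- and the pairs with gcd d are divided by d.
∑-coprimePairs : ∀ c n → ∑ℕ n (λ e → coprimePairs c (n div suc e)) ≡ pairs c n
∑-coprimePairs c n = sym (begin
  pairs c n
    ≡⟨ ∑ℕ-cong n (λ m m<n → ∑ℕ-cong n (λ h _ → sym (begin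
         ∑ℕ n (λ e → ⟦ suc h * c ≤? suc m ⟧ * ⟦ gcd (suc h) (suc m) ≟ suc e ⟧)
           ≡⟨ ∑ℕ-*ˡ n ⟦ suc h * c ≤? suc m ⟧ (λ e → ⟦ gcd (suc h) (suc m) ≟ suc e ⟧) ⟩
         ⟦ suc h * c ≤? suc m ⟧ * ∑ℕ n (λ e → ⟦ gcd (suc h) (suc m) ≟ suc e ⟧)
           ≡⟨ cong (⟦ suc h * c ≤? suc m ⟧ *_) (∑-gcd≡1 n {h} m<n) ⟩
         ⟦ suc h * c ≤? suc m ⟧ * 1
           ≡⟨ ℕₚ.*-identityʳ _ ⟩
         ⟦ suc h * c ≤? suc m ⟧ ∎))) ⟩
  ∑ℕ n (λ m → ∑ℕ n λ h → ∑ℕ n λ e → F (suc e) (suc h) (suc m))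
    ≡⟨ ∑ℕ-cong n (λ m _ → ∑ℕ-swap n n (λ h e → F (suc e) (suc h) (suc m))) ⟩
  ∑ℕ n (λ m → ∑ℕ n λ e → ∑ℕ n λ h → F (suc e) (suc h) (suc m))
    ≡⟨ ∑ℕ-swap n n (λ m e → ∑ℕ n λ h → F (suc e) (suc h) (suc m)) ⟩
  ∑ℕ n (λ e → ∑ℕ n λ m → ∑ℕ n λ h → F (suc e) (suc h) (suc m))
    ≡⟨ ∑ℕ-cong n (λ e _ → dilate e) ⟩
  ∑ℕ n (λ e → coprimePairs c (n div suc e)) ∎)
  where
  open ≡-Reasoning
  F : ℕ → ℕ → ℕ → ℕ
  F d h m = ⟦ h * c ≤? m ⟧ * ⟦ gcd h m ≟ d ⟧

  F≡0 : ∀ d h m → gcd h m ≢ d → F d h m ≡ 0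
  F≡0 d h m gcd≢d =
    trans (cong (⟦ h * c ≤? m ⟧ *_) (⟦⟧-no (gcd h m ≟ d) gcd≢d)) (ℕₚ.*-zeroʳ ⟦ h * c ≤? m ⟧)

  -- Both conditions are homogeneous: the factor `suc e` cancels from the inequality and pulls out
  -- of the gcd.
  F-dilate : ∀ e a b → F (suc e) (a * suc e) (b * suc e) ≡ ⟦ gcd a b ≟ 1 ⟧ * ⟦ a * c ≤? b ⟧
  F-dilate e a b = trans (cong₂ _*_
    (⟦⟧-cong (a * d * c ≤? b * d) (a * c ≤? b)
      (λ h → ℕₚ.*-cancelʳ-≤ (a * c) b d (subst (_≤ b * d) adc≡acd h))
      (λ h → subst (_≤ b * d) (sym adc≡acd) (ℕₚ.*-monoˡ-≤ d h)))
    (⟦⟧-cong (gcd (a * d) (b * d) ≟ d) (gcd a b ≟ 1)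
      (λ h → ℕₚ.*-cancelˡ-≡ (gcd a b) 1 d (trans dgcd (trans h (sym (ℕₚ.*-identityʳ d)))))
      (λ h → trans (sym dgcd) (trans (cong (d *_) h) (ℕₚ.*-identityʳ d)))))
    (ℕₚ.*-comm ⟦ a * c ≤? b ⟧ ⟦ gcd a b ≟ 1 ⟧)
    where
    d : ℕ
    d = suc e
    adc≡acd : a * d * c ≡ a * c * d
    adc≡acd = solve 3 (λ a d c → a :* d :* c := a :* c :* d) refl a d c
      where open ℕ-Solver
    dgcd : d * gcd a b ≡ gcd (a * d) (b * d)
    dgcd = trans (c*gcd[m,n]≡gcd[cm,cn] d a b) (cong₂ gcd (ℕₚ.*-comm d a) (ℕₚ.*-comm d b))

  -- A gcd equal to d forces d to divide both entries, so first m and then h can be restricted to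
  -- multiples of d.
  dilate : ∀ e → ∑ℕ n (λ m → ∑ℕ n λ h → F (suc e) (suc h) (suc m)) ≡ coprimePairs c (n div suc e)
  dilate e = begin
    ∑ℕ n (λ m → ∑ℕ n λ h → F d (suc h) (suc m))
      ≡⟨ ∑ℕ-multiples n e (λ m → ∑ℕ n λ h → F d (suc h) m) (λ m d∤m →
           trans (∑ℕ-cong n (λ h _ → F≡0 d (suc h) (suc m) λ gcd≡d →
             d∤m (subst (_∣ suc m) gcd≡d (gcd[m,n]∣n (suc h) (suc m))))) (∑ℕ-0 n)) ⟩
    ∑ℕ (n div d) (λ m → ∑ℕ n λ h → F d (suc h) (suc m * d))
      ≡⟨ ∑ℕ-cong (n div d) (λ m _ → ∑ℕ-multiples n e (λ h → F d h (suc m * d)) (λ h d∤h →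
           F≡0 d (suc h) (suc m * d) λ gcd≡d → d∤h (subst (_∣ suc h) gcd≡d (gcd[m,n]∣m (suc h) (suc m * d))))) ⟩
    ∑ℕ (n div d) (λ m → ∑ℕ (n div d) λ h → F d (suc h * d) (suc m * d))
      ≡⟨ ∑ℕ-cong (n div d) (λ m _ → ∑ℕ-cong (n div d) (λ h _ → F-dilate e (suc h) (suc m))) ⟩
    coprimePairs c (n div d) ∎
    where
    d : ℕ
    d = suc e

-- Lengths of filtered lists as sums, and the summatory totient.

-- Stated for `applyUpTo f` and not just for `upTo`, because the recursion replaces `f` by its
-- shift.
length-filter-applyUpTo : ∀ {a p} {A : Set a} {P : A → Set p} (P? : Decidable P) f n →
  length (filter P? (applyUpTo f n)) ≡ ∑ℕ n (λ i → ⟦ P? (f i) ⟧)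
length-filter-applyUpTo P? f zero    = refl
length-filter-applyUpTo P? f (suc n) = trans step (sym (∑ℕ-split-first n (λ i → ⟦ P? (f i) ⟧)))
  where
  step : length (filter P? (applyUpTo f (suc n))) ≡ ⟦ P? (f 0) ⟧ + ∑ℕ n (λ i → ⟦ P? (f (suc i)) ⟧)
  step with P? (f 0)
  ... | yes _ = cong suc (length-filter-applyUpTo P? (λ i → f (suc i)) n)
  ... | no _  = length-filter-applyUpTo P? (λ i → f (suc i)) n

length-filter-map-filter-applyUpTo :
  ∀ {a b p q} {A : Set a} {B : Set b} {P : A → Set p} {Q : B → Set q}
  (P? : Decidable P) (Q? : Decidable Q) g f n →
  length (filter Q? (map g (filter P? (applyUpTo f n)))) ≡ ∑ℕ n (λ i → ⟦ P? (f i) ⟧ * ⟦ Q? (g (f i)) ⟧)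
length-filter-map-filter-applyUpTo P? Q? g f zero    = refl
length-filter-map-filter-applyUpTo P? Q? g f (suc n) =
  trans step (sym (∑ℕ-split-first n (λ i → ⟦ P? (f i) ⟧ * ⟦ Q? (g (f i)) ⟧)))
  where
  ih : _
  ih = length-filter-map-filter-applyUpTo P? Q? g (λ i → f (suc i)) n
  step : length (filter Q? (map g (filter P? (applyUpTo f (suc n))))) ≡
         ⟦ P? (f 0) ⟧ * ⟦ Q? (g (f 0)) ⟧ + ∑ℕ n (λ i → ⟦ P? (f (suc i)) ⟧ * ⟦ Q? (g (f (suc i))) ⟧)
  step with P? (f 0)
  ... | no _  = ih
  ... | yes _ with Q? (g (f 0))
  ... | yes _ = cong suc ih
  ... | no _  = ih

length-filter-concatMap-applyUpTo :
  ∀ {a b q} {A : Set a} {B : Set b} {Q : B → Set q} (Q? : Decidable Q) (r : A → List B) f n →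
  length (filter Q? (concatMap r (applyUpTo f n))) ≡ ∑ℕ n (λ i → length (filter Q? (r (f i))))
length-filter-concatMap-applyUpTo Q? r f zero    = refl
length-filter-concatMap-applyUpTo Q? r f (suc n) = begin
  length (filter Q? (concatMap r (applyUpTo f (suc n))))
    ≡⟨ cong length (filter-++ Q? (r (f 0)) _) ⟩
  length (filter Q? (r (f 0)) ++ filter Q? rest)
    ≡⟨ length-++ (filter Q? (r (f 0))) ⟩
  length (filter Q? (r (f 0))) + length (filter Q? rest)
    ≡⟨ cong (λ k → length (filter Q? (r (f 0))) + k) (length-filter-concatMap-applyUpTo Q? r (λ i → f (suc i)) n) ⟩
  length (filter Q? (r (f 0))) + ∑ℕ n (λ i → length (filter Q? (r (f (suc i)))))
    ≡⟨ ∑ℕ-split-first n (λ i → length (filter Q? (r (f i)))) ⟨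
  ∑ℕ (suc n) (λ i → length (filter Q? (r (f i)))) ∎
  where
  open ≡-Reasoning
  rest = concatMap r (applyUpTo (λ i → f (suc i)) n)

-- With c = 1 the inequality reads h ≤ m, so row m counts the h from 1 to m that are coprime to m.
∑-φ : ∀ n → ∑ℕ n (λ k → φ (suc k)) ≡ coprimePairs 1 n
∑-φ n = ∑ℕ-cong n λ k k<n → begin
  φ (suc k)
    ≡⟨ length-filter-applyUpTo (λ m → gcd (suc m) (suc k) ≟ 1) (λ m → m) (suc k) ⟩
  ∑ℕ (suc k) (λ h → ⟦ gcd (suc h) (suc k) ≟ 1 ⟧)
    ≡⟨ ∑ℕ-cong (suc k) (λ h h≤k → trans (sym (ℕₚ.*-identityʳ _)) (cong (⟦ gcd (suc h) (suc k) ≟ 1 ⟧ *_)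
         (sym (⟦⟧-yes (suc h * 1 ≤? suc k) (subst (_≤ suc k) (sym (ℕₚ.*-identityʳ (suc h))) h≤k))))) ⟩
  ∑ℕ (suc k) (λ h → ⟦ gcd (suc h) (suc k) ≟ 1 ⟧ * ⟦ suc h * 1 ≤? suc k ⟧)
    ≡⟨ ∑ℕ-truncate _ k<n (λ h k<h _ → trans (cong (⟦ gcd (suc h) (suc k) ≟ 1 ⟧ *_)
         (⟦⟧-no (suc h * 1 ≤? suc k) (λ h≤k → ℕₚ.<⇒≱ k<h
           (ℕₚ.≤-pred (subst (_≤ suc k) (ℕₚ.*-identityʳ (suc h)) h≤k))))) (ℕₚ.*-zeroʳ ⟦ gcd (suc h) (suc k) ≟ 1 ⟧)) ⟨
  ∑ℕ n (λ h → ⟦ gcd (suc h) (suc k) ≟ 1 ⟧ * ⟦ suc h * 1 ≤? suc k ⟧) ∎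
  where open ≡-Reasoning

pairs-1 : ∀ n → pairs 1 n ≡ ∑ℕ n suc
pairs-1 n = ∑ℕ-cong n λ m m<n → begin
  ∑ℕ n (λ h → ⟦ suc h * 1 ≤? suc m ⟧)
    ≡⟨ ∑ℕ-truncate _ m<n (λ h m<h _ → ⟦⟧-no (suc h * 1 ≤? suc m) (λ h≤m → ℕₚ.<⇒≱ m<h
         (ℕₚ.≤-pred (subst (_≤ suc m) (ℕₚ.*-identityʳ (suc h)) h≤m)))) ⟩
  ∑ℕ (suc m) (λ h → ⟦ suc h * 1 ≤? suc m ⟧)
    ≡⟨ ∑ℕ-cong (suc m) (λ h h≤m →
         ⟦⟧-yes (suc h * 1 ≤? suc m) (subst (_≤ suc m) (sym (ℕₚ.*-identityʳ (suc h))) h≤m)) ⟩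
  ∑ℕ (suc m) (λ _ → 1)
    ≡⟨ ∑ℕ-const (suc m) 1 ⟩
  suc m * 1
    ≡⟨ ℕₚ.*-identityʳ (suc m) ⟩
  suc m ∎
  where open ≡-Reasoning

-- The exact identity for the weighted pair count.

-- The k with hk ≤ m are those up to ⌊m/h⌋, so their totients add up to a count of coprime pairs at
-- ⌊m/h⌋, ready for a second use of `∑-coprimePairs`. The bound on `K` keeps all these k in range.
∑-φ*multiples : ∀ K h m → suc m ≤ K →
  ∑ℕ K (λ k → φ (suc k) * ⟦ suc h * suc k ≤? suc m ⟧) ≡ coprimePairs 1 (suc m div suc h)
∑-φ*multiples K h m m<K = begin
  ∑ℕ K (λ k → φ (suc k) * ⟦ suc h * suc k ≤? suc m ⟧)
    ≡⟨ ∑ℕ-truncate _ (ℕₚ.≤-trans (m/n≤m (suc m) (suc h)) m<K) (λ k q≤k _ → trans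
         (cong (φ (suc k) *_) (⟦⟧-no (suc h * suc k ≤? suc m) (λ hk≤m → ℕₚ.<⇒≱ (beyond k q≤k) hk≤m)))
         (ℕₚ.*-zeroʳ (φ (suc k)))) ⟩
  ∑ℕ q (λ k → φ (suc k) * ⟦ suc h * suc k ≤? suc m ⟧)
    ≡⟨ ∑ℕ-cong q (λ k k<q → trans
         (cong (φ (suc k) *_) (⟦⟧-yes (suc h * suc k ≤? suc m) (below k k<q)))
         (ℕₚ.*-identityʳ (φ (suc k)))) ⟩
  ∑ℕ q (λ k → φ (suc k))
    ≡⟨ ∑-φ q ⟩
  coprimePairs 1 q ∎
  where
  q : ℕ
  q = suc m div suc h
  below : ∀ k → k < q → suc h * suc k ≤ suc m
  below k k<q = ℕₚ.≤-trans (ℕₚ.*-monoʳ-≤ (suc h) k<q)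
    (subst (_≤ suc m) (ℕₚ.*-comm q (suc h)) (m/n*n≤m (suc m) (suc h)))
  beyond : ∀ k → q ≤ k → suc m < suc h * suc k
  beyond k q≤k = begin-strict
    suc m                            ≡⟨ m≡m%n+[m/n]*n (suc m) (suc h) ⟩
    suc m ℕ.% suc h + q * suc h      <⟨ ℕₚ.+-monoˡ-< (q * suc h) (m%n<n (suc m) (suc h)) ⟩
    suc q * suc h                    ≤⟨ ℕₚ.*-monoˡ-≤ (suc h) (s≤s q≤k) ⟩
    suc k * suc h                    ≡⟨ ℕₚ.*-comm (suc k) (suc h) ⟩
    suc h * suc k                    ∎
    where open ℕₚ.≤-Reasoning
  open ≡-Reasoning

-- For K ≥ n this is T(n) of the opening comment, since hk ≤ m ≤ n leaves nothing for k > n. A range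
-- `K` separate from `n` lets one weighting serve all quotients ⌊n/d⌋, so that the sums can be
-- exchanged.
weightedPairs : ℕ → ℕ → ℕ
weightedPairs K n = ∑ℕ K λ k → φ (suc k) * coprimePairs (suc k) n

-- Sums of triangular numbers are tetrahedral; the factors 6 and 2 keep the inductions free of
-- division.
6∑∑ : ∀ n → 6 * ∑ℕ n (λ m → ∑ℕ (suc m) suc) ≡ n * suc n * suc (suc n)
6∑∑ zero    = refl
6∑∑ (suc n) = begin
  6 * (∑ℕ n (λ m → ∑ℕ (suc m) suc) + ∑ℕ (suc n) suc)
    ≡⟨ solve 2 (λ a b → con 6 :* (a :+ b) := con 6 :* a :+ con 3 :* (con 2 :* b)) refl
         (∑ℕ n (λ m → ∑ℕ (suc m) suc)) (∑ℕ (suc n) suc) ⟩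
  6 * ∑ℕ n (λ m → ∑ℕ (suc m) suc) + 3 * (2 * ∑ℕ (suc n) suc)
    ≡⟨ cong₂ (λ a b → a + 3 * b) (6∑∑ n) (2∑ (suc n)) ⟩
  n * suc n * suc (suc n) + 3 * (suc n * suc (suc n))
    ≡⟨ solve 1 (λ n → let m = con 1 :+ n ; p = con 1 :+ m in
         n :* m :* p :+ con 3 :* (m :* p) := m :* p :* (con 1 :+ p)) refl n ⟩
  suc n * suc (suc n) * suc (suc (suc n)) ∎
  where
  open ≡-Reasoning
  open ℕ-Solver
  2∑ : ∀ n → 2 * ∑ℕ n suc ≡ n * suc n
  2∑ zero    = refl
  2∑ (suc n) = begin
    2 * (∑ℕ n suc + suc n)       ≡⟨ ℕₚ.*-distribˡ-+ 2 (∑ℕ n suc) (suc n) ⟩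
    2 * ∑ℕ n suc + 2 * suc n     ≡⟨ cong (_+ 2 * suc n) (2∑ n) ⟩
    n * suc n + 2 * suc n        ≡⟨ solve 1 (λ n → let m = con 1 :+ n in
                                     n :* m :+ con 2 :* m := m :* (con 1 :+ m)) refl n ⟩
    suc n * suc (suc n)          ∎

-- Summing over e removes the coprimality of h and m for every k; summing the totients over k then
-- gives counts at ⌊m/h⌋; summing these over h ≤ m removes coprimality again and leaves triangular
-- numbers.
∑-weightedPairs : ∀ {K n} → n ≤ K →
  6 * ∑ℕ n (λ e → weightedPairs K (n div suc e)) ≡ n * suc n * suc (suc n)
∑-weightedPairs {K} {n} n≤K = trans (cong (6 *_) (begin
  ∑ℕ n (λ e → weightedPairs K (n div suc e))
    ≡⟨ ∑ℕ-swap n K (λ e k → φ (suc k) * coprimePairs (suc k) (n div suc e)) ⟩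
  ∑ℕ K (λ k → ∑ℕ n λ e → φ (suc k) * coprimePairs (suc k) (n div suc e))
    ≡⟨ ∑ℕ-cong K (λ k _ → trans (∑ℕ-*ˡ n (φ (suc k)) (λ e → coprimePairs (suc k) (n div suc e)))
         (cong (φ (suc k) *_) (∑-coprimePairs (suc k) n))) ⟩
  ∑ℕ K (λ k → φ (suc k) * pairs (suc k) n)
    ≡⟨ ∑ℕ-cong K (λ k _ → trans (sym (∑ℕ-*ˡ n (φ (suc k)) _)) (∑ℕ-cong n λ m _ → sym (∑ℕ-*ˡ n (φ (suc k)) _))) ⟩
  ∑ℕ K (λ k → ∑ℕ n λ m → ∑ℕ n λ h → φ (suc k) * ⟦ suc h * suc k ≤? suc m ⟧)
    ≡⟨ ∑ℕ-swap K n (λ k m → ∑ℕ n λ h → φ (suc k) * ⟦ suc h * suc k ≤? suc m ⟧) ⟩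
  ∑ℕ n (λ m → ∑ℕ K λ k → ∑ℕ n λ h → φ (suc k) * ⟦ suc h * suc k ≤? suc m ⟧)
    ≡⟨ ∑ℕ-cong n (λ m _ → ∑ℕ-swap K n (λ k h → φ (suc k) * ⟦ suc h * suc k ≤? suc m ⟧)) ⟩
  ∑ℕ n (λ m → ∑ℕ n λ h → ∑ℕ K λ k → φ (suc k) * ⟦ suc h * suc k ≤? suc m ⟧)
    ≡⟨ ∑ℕ-cong n (λ m m<n → ∑ℕ-cong n λ h _ → ∑-φ*multiples K h m (ℕₚ.≤-trans m<n n≤K)) ⟩
  ∑ℕ n (λ m → ∑ℕ n λ h → coprimePairs 1 (suc m div suc h))
    -- For h > m the quotient is 0 and `coprimePairs 1 0` computes to 0; the range shrinks to the
    -- one required by `∑-coprimePairs 1 (suc m)`.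
    ≡⟨ ∑ℕ-cong n (λ m m<n → ∑ℕ-truncate _ m<n (λ h m<h _ →
         cong (coprimePairs 1) (m<n⇒m/n≡0 (s≤s m<h)))) ⟩
  ∑ℕ n (λ m → ∑ℕ (suc m) λ h → coprimePairs 1 (suc m div suc h))
    ≡⟨ ∑ℕ-cong n (λ m _ → trans (∑-coprimePairs 1 (suc m)) (pairs-1 (suc m))) ⟩
  ∑ℕ n (λ m → ∑ℕ (suc m) suc) ∎)) (6∑∑ n)
  where open ≡-Reasoning

-- Positions in the Farey sequence and coprime pairs.

/-cancel-≤ : ∀ a b c d .{{_ : ℕ.NonZero b}} .{{_ : ℕ.NonZero d}} →
             + a / b ℚ.≤ + c / d → a * d ≤ c * b
/-cancel-≤ a b@(suc _) c d@(suc _) h = ℤₚ.drop‿+≤+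
  (subst₂ ℤ._≤_ (sym (ℤₚ.pos-* a d)) (sym (ℤₚ.pos-* c b)) (ℚᵘₚ.drop-*≤*
    (ℚᵘₚ.≤-respˡ-≃ (ℚₚ.toℚᵘ-fromℚᵘ (ℚᵘ.mkℚᵘ (+ a) _))
    (ℚᵘₚ.≤-respʳ-≃ (ℚₚ.toℚᵘ-fromℚᵘ (ℚᵘ.mkℚᵘ (+ c) _)) (ℚₚ.toℚᵘ-mono-≤ h)))))

module _ {a r q} {A : Set a} {R : A → A → Set r} {Q : A → Set q} (Q? : Decidable Q) where
  -- From the position of `v` on nothing satisfies `Q`. `R` will be the non-strict order and `Q` the
  -- entries strictly below `v`.
  count≤index : ∀ {v xs} → ¬ Q v → (∀ {y} → R v y → ¬ Q y) →
    AllPairs R xs → (v∈xs : v ∈ xs) → length (filter Q? xs) ≤ toℕ (index v∈xs)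
  count≤index {v} {_ ∷ xs} ¬Qv above (Rvxs ∷ _) (here refl) = ℕₚ.≤-reflexive
    (cong length (filter-none Q? {v ∷ xs} (¬Qv All.∷ All.map above Rvxs)))
  count≤index {v} {x ∷ xs} ¬Qv above (_ ∷ sorted) (there v∈xs) with Q? x
  ... | yes _ = s≤s (count≤index ¬Qv above sorted v∈xs)
  ... | no _  = ℕₚ.m≤n⇒m≤1+n (count≤index ¬Qv above sorted v∈xs)

  -- Entries before `v` are `R`-related to it and so satisfy `Q`; `v` does too, which makes the
  -- inequality strict. Here `Q` will be the entries up to `v`.
  index<count : ∀ {v xs} → Q v → (∀ {y} → R y v → Q y) →
    AllPairs R xs → (v∈xs : v ∈ xs) → toℕ (index v∈xs) < length (filter Q? xs)
  index<count {v} Qv below (_ ∷ _) (here refl) with Q? v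
  ... | yes _  = s≤s z≤n
  ... | no ¬Qv = ⊥-elim (¬Qv Qv)
  index<count {v} {x ∷ xs} Qv below (Rxxs ∷ sorted) (there v∈xs) with Q? x
  ... | yes _  = s≤s (index<count Qv below sorted v∈xs)
  ... | no ¬Qx = ⊥-elim (¬Qx (below (All.lookup Rxxs v∈xs)))

farey-sorted : ∀ N → AllPairs ℚ._≤_ (farey N)
farey-sorted N = Linked⇒AllPairs ℚₚ.≤-trans (sort-↗ (concatMap row (upTo N)))

-- Sorting only permutes, so the count can be made on the unsorted rows, by denominator and
-- numerator.
count-farey : ∀ {q} {Q : ℚ → Set q} (Q? : Decidable Q) N → length (filter Q? (farey N)) ≡
  ∑ℕ N (λ i → ∑ℕ (suc (suc i)) λ h → ⟦ gcd h (suc i) ≟ 1 ⟧ * ⟦ Q? (+ h / suc i) ⟧)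
count-farey Q? N = begin
  length (filter Q? (farey N))
    ≡⟨ ↭-length (filter-↭ Q? (sort-↭ (concatMap row (upTo N)))) ⟩
  length (filter Q? (concatMap row (upTo N)))
    ≡⟨ length-filter-concatMap-applyUpTo Q? row (λ i → i) N ⟩
  ∑ℕ N (λ i → length (filter Q? (row i)))
    ≡⟨ ∑ℕ-cong N (λ i _ → length-filter-map-filter-applyUpTo
         (λ h → gcd h (suc i) ≟ 1) Q? (λ h → + h / suc i) (λ h → h) (suc (suc i))) ⟩
  ∑ℕ N (λ i → ∑ℕ (suc (suc i)) λ h → ⟦ gcd h (suc i) ≟ 1 ⟧ * ⟦ Q? (+ h / suc i) ⟧) ∎
  where open ≡-Reasoning

-- Since k ≥ 1, hk ≤ m gives h ≤ m, which is the range of positive numerators in a Farey row.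
coprimePairs-row : ∀ κ {m n} → m < n →
  ∑ℕ n (λ h → ⟦ gcd (suc h) (suc m) ≟ 1 ⟧ * ⟦ suc h * suc κ ≤? suc m ⟧) ≡
  ∑ℕ (suc m) (λ h → ⟦ gcd (suc h) (suc m) ≟ 1 ⟧ * ⟦ suc h * suc κ ≤? suc m ⟧)
coprimePairs-row κ {m} m<n = ∑ℕ-truncate _ m<n λ h m<h _ → trans
  (cong (⟦ gcd (suc h) (suc m) ≟ 1 ⟧ *_) (⟦⟧-no (suc h * suc κ ≤? suc m) λ hk≤m →
    ℕₚ.<⇒≱ (s≤s m<h) (ℕₚ.≤-trans (ℕₚ.m≤m*n (suc h) (suc κ)) hk≤m)))
  (ℕₚ.*-zeroʳ ⟦ gcd (suc h) (suc m) ≟ 1 ⟧)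

-- The position is at most the number of entries up to 1/k. Besides the coprime pairs with h ≥ 1
-- only 0/1 is counted, which is the summand 1.
I≤1+coprimePairs : ∀ N κ (x∈F : + 1 / suc κ ∈ farey N) →
  I N (+ 1 / suc κ) x∈F ≤ 1 + coprimePairs (suc κ) N
I≤1+coprimePairs N κ x∈F = begin
  I N x x∈F
    ≤⟨ index<count (ℚₚ._≤? x) ℚₚ.≤-refl (λ y≤x → y≤x) (farey-sorted N) x∈F ⟩
  length (filter (ℚₚ._≤? x) (farey N))
    ≡⟨ count-farey (ℚₚ._≤? x) N ⟩
  ∑ℕ N (λ i → ∑ℕ (suc (suc i)) (F i))
    ≡⟨ ∑ℕ-cong N (λ i _ → ∑ℕ-split-first (suc i) (F i)) ⟩
  ∑ℕ N (λ i → F i 0 + ∑ℕ (suc i) (λ h → F i (suc h)))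
    ≡⟨ ∑ℕ-+ N (λ i → F i 0) (λ i → ∑ℕ (suc i) (λ h → F i (suc h))) ⟩
  ∑ℕ N (λ i → F i 0) + ∑ℕ N (λ i → ∑ℕ (suc i) (λ h → F i (suc h)))
    -- As gcd(0, m) = m, the numerator 0 occurs only in the row of denominator 1.
    ≤⟨ ℕₚ.+-mono-≤ (ℕₚ.≤-trans (∑ℕ-mono N λ i _ → zero-term i) (∑ℕ-δ≤ 0 N (λ _ → 1)))
         (∑ℕ-mono N λ i i<N → ℕₚ.≤-trans (∑ℕ-mono (suc i) λ h _ → positive-term i h)
           (ℕₚ.≤-reflexive (sym (coprimePairs-row κ i<N)))) ⟩
  1 + coprimePairs (suc κ) N ∎
  where
  open ℕₚ.≤-Reasoning
  x : ℚ
  x = + 1 / suc κ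
  F : ℕ → ℕ → ℕ
  F i h = ⟦ gcd h (suc i) ≟ 1 ⟧ * ⟦ + h / suc i ℚₚ.≤? x ⟧
  ⟦⟧≤1 : ∀ {p} {P : Set p} (P? : Dec P) → ⟦ P? ⟧ ≤ 1
  ⟦⟧≤1 (yes _) = ℕₚ.≤-refl
  ⟦⟧≤1 (no _)  = z≤n
  zero-term : ∀ i → F i 0 ≤ ⟦ 0 ≟ i ⟧ * 1
  zero-term i = ℕₚ.*-mono-≤
    (⟦⟧-mono (gcd 0 (suc i) ≟ 1) (0 ≟ i) λ e →
      sym (ℕₚ.suc-injective (trans (sym (gcd-identityˡ (suc i))) e)))
    (⟦⟧≤1 (+ 0 / suc i ℚₚ.≤? x))
  positive-term : ∀ i h → F i (suc h) ≤ ⟦ gcd (suc h) (suc i) ≟ 1 ⟧ * ⟦ suc h * suc κ ≤? suc i ⟧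
  positive-term i h = ℕₚ.*-monoʳ-≤ ⟦ gcd (suc h) (suc i) ≟ 1 ⟧
    (⟦⟧-mono (+ suc h / suc i ℚₚ.≤? x) (suc h * suc κ ≤? suc i) λ le →
      subst (suc h * suc κ ≤_) (ℕₚ.*-identityˡ (suc i)) (/-cancel-≤ (suc h) (suc i) 1 (suc κ) le))

-- A union bound for brackets: when A and B both hold, one of the alternatives makes a summand on
-- the right equal to 1.
⟦⟧*⟦⟧≤ : ∀ {a b c d e} {A : Set a} {B : Set b} {C : Set c} {D : Set d} {E : Set e}
  (A? : Dec A) (B? : Dec B) (C? : Dec C) (D? : Dec D) (E? : Dec E) →
  (A → B → C ⊎ (D × E)) → ⟦ A? ⟧ * ⟦ B? ⟧ ≤ ⟦ A? ⟧ * ⟦ C? ⟧ + ⟦ D? ⟧ * ⟦ E? ⟧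
⟦⟧*⟦⟧≤ (no _)  _       _  _  _  f = z≤n
⟦⟧*⟦⟧≤ (yes _) (no _)  _  _  _  f = z≤n
⟦⟧*⟦⟧≤ (yes a) (yes b) C? D? E? f with f a b
... | inj₁ c       rewrite ⟦⟧-yes C? c = s≤s z≤n
... | inj₂ (d , e) rewrite ⟦⟧-yes D? d | ⟦⟧-yes E? e = ℕₚ.m≤n+m 1 _

-- Among the pairs counted by coprimePairs (suc κ), only h/m = 1/(suc κ) is not strictly below 1/(suc κ).
coprimePairs≤I : ∀ N κ (x∈F : + 1 / suc κ ∈ farey N) →
  coprimePairs (suc κ) N ≤ I N (+ 1 / suc κ) x∈F
coprimePairs≤I N κ x∈F = begin
  coprimePairs (suc κ) N
    ≡⟨ ∑ℕ-cong N (λ i i<N → coprimePairs-row κ i<N) ⟩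
  ∑ℕ N (λ i → ∑ℕ (suc i) λ h → ⟦ gcd (suc h) (suc i) ≟ 1 ⟧ * ⟦ suc h * suc κ ≤? suc i ⟧)
    ≤⟨ ∑ℕ-mono N (λ i _ → ∑ℕ-mono (suc i) λ h _ → ⟦⟧*⟦⟧≤ (gcd (suc h) (suc i) ≟ 1)
         (suc h * suc κ ≤? suc i) (+ suc h / suc i ℚₚ.<? x) (0 ≟ h) (κ ≟ i) (below-or-equal i h)) ⟩
  ∑ℕ N (λ i → ∑ℕ (suc i) λ h → F i (suc h) + ⟦ 0 ≟ h ⟧ * ⟦ κ ≟ i ⟧)
    ≡⟨ ∑ℕ-cong N (λ i _ → ∑ℕ-+ (suc i) (λ h → F i (suc h)) (λ h → ⟦ 0 ≟ h ⟧ * ⟦ κ ≟ i ⟧)) ⟩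
  ∑ℕ N (λ i → ∑ℕ (suc i) (λ h → F i (suc h)) + ∑ℕ (suc i) (λ h → ⟦ 0 ≟ h ⟧ * ⟦ κ ≟ i ⟧))
    ≤⟨ ∑ℕ-mono N (λ i _ → ℕₚ.+-mono-≤
         (ℕₚ.≤-trans (ℕₚ.m≤n+m _ (F i 0)) (ℕₚ.≤-reflexive (sym (∑ℕ-split-first (suc i) (F i)))))
         (ℕₚ.≤-trans (∑ℕ-δ≤ 0 (suc i) (λ _ → ⟦ κ ≟ i ⟧)) (ℕₚ.≤-reflexive (sym (ℕₚ.*-identityʳ _))))) ⟩
  ∑ℕ N (λ i → ∑ℕ (suc (suc i)) (F i) + ⟦ κ ≟ i ⟧ * 1)
    ≡⟨ ∑ℕ-+ N (λ i → ∑ℕ (suc (suc i)) (F i)) (λ i → ⟦ κ ≟ i ⟧ * 1) ⟩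
  ∑ℕ N (λ i → ∑ℕ (suc (suc i)) (F i)) + ∑ℕ N (λ i → ⟦ κ ≟ i ⟧ * 1)
    -- The exceptional pair adds at most 1 in total, which is the offset of a position counted from
    -- 1.
    ≤⟨ ℕₚ.+-mono-≤ (ℕₚ.≤-trans (ℕₚ.≤-reflexive (sym (count-farey (ℚₚ._<? x) N)))
         (count≤index (ℚₚ._<? x) (ℚₚ.<-irrefl refl)
           (λ x≤y y<x → ℚₚ.<-irrefl refl (ℚₚ.<-≤-trans y<x x≤y)) (farey-sorted N) x∈F)) (∑ℕ-δ≤ κ N (λ _ → 1)) ⟩
  toℕ (index x∈F) + 1
    ≡⟨ ℕₚ.+-comm _ 1 ⟩
  I N x x∈F ∎
  where
  open ℕₚ.≤-Reasoning
  x : ℚ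
  x = + 1 / suc κ
  F : ℕ → ℕ → ℕ
  F i h = ⟦ gcd h (suc i) ≟ 1 ⟧ * ⟦ + h / suc i ℚₚ.<? x ⟧
  below-or-equal : ∀ i h → gcd (suc h) (suc i) ≡ 1 → suc h * suc κ ≤ suc i →
           + suc h / suc i ℚ.< x ⊎ (0 ≡ h × κ ≡ i)
  below-or-equal i h coprime hk≤i with ℕₚ.m≤n⇒m<n∨m≡n hk≤i
  ... | inj₁ hk<i = inj₁ (ℚₚ.≰⇒> λ le → ℕₚ.<⇒≱ hk<i
          (subst (_≤ suc h * suc κ) (ℕₚ.*-identityˡ (suc i)) (/-cancel-≤ 1 (suc κ) (suc h) (suc i) le)))
  -- Equality makes h divide m, so coprimality forces h = 1 and then m = k.
  ... | inj₂ hk≡i = inj₂ (sym h≡0 , κ≡i)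
    where
    1+h∣1+i : suc h ∣ suc i
    1+h∣1+i = divides (suc κ) (trans (sym hk≡i) (ℕₚ.*-comm (suc h) (suc κ)))
    h≡0 : h ≡ 0
    h≡0 = ℕₚ.suc-injective (∣1⇒≡1 (subst (suc h ∣_) coprime (gcd-greatest ∣-refl 1+h∣1+i)))
    κ≡i : κ ≡ i
    κ≡i = ℕₚ.suc-injective (trans (sym (ℕₚ.*-identityˡ (suc κ)))
      (trans (cong (λ h → suc h * suc κ) (sym h≡0)) hk≡i))

-- Comparing the sum in the theorem with the weighted pair count.

sum-tabulate-≤ : ∀ n {f : Fin n → ℕ} {g} → (∀ i → f i ≤ g (toℕ i)) → sum (tabulate f) ≤ ∑ℕ n g
sum-tabulate-≤ zero    h = z≤n
sum-tabulate-≤ (suc n) {f} {g} h = subst (sum (tabulate f) ≤_) (sym (∑ℕ-split-first n g))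
  (ℕₚ.+-mono-≤ (h Fin.zero) (sum-tabulate-≤ n (λ i → h (Fin.suc i))))

sum-tabulate-≥ : ∀ n {f : Fin n → ℕ} {g} → (∀ i → g (toℕ i) ≤ f i) → ∑ℕ n g ≤ sum (tabulate f)
sum-tabulate-≥ zero    h = z≤n
sum-tabulate-≥ (suc n) {f} {g} h = subst (_≤ sum (tabulate f)) (sym (∑ℕ-split-first n g))
  (ℕₚ.+-mono-≤ (h Fin.zero) (sum-tabulate-≥ n (λ i → h (Fin.suc i))))

φ≤n : ∀ n → φ n ≤ n
φ≤n n = subst (φ n ≤_) (length-upTo n) (length-filter _ (upTo n))

∑φI : ℕ → ℕ
∑φI N = sum (tabulate {n = N} λ i → φ (suc (toℕ i)) * I N (+ 1 / suc (toℕ i)) (1/k∈farey i))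

weightedPairs≤∑φI : ∀ N → weightedPairs N N ≤ ∑φI N
weightedPairs≤∑φI N = sum-tabulate-≥ N λ i →
  ℕₚ.*-monoʳ-≤ (φ (suc (toℕ i))) (coprimePairs≤I N (toℕ i) (1/k∈farey i))

-- The 1 in `I≤1+coprimePairs` contributes the sum of φ(k) over k ≤ N, and φ(k) ≤ k ≤ N bounds it by
-- N².
∑φI≤N²+weightedPairs : ∀ N → ∑φI N ≤ N * N + weightedPairs N N
∑φI≤N²+weightedPairs N = begin
  ∑φI N
    ≤⟨ sum-tabulate-≤ N (λ i →
         ℕₚ.*-monoʳ-≤ (φ (suc (toℕ i))) (I≤1+coprimePairs N (toℕ i) (1/k∈farey i))) ⟩
  ∑ℕ N (λ k → φ (suc k) * (1 + coprimePairs (suc k) N))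
    ≡⟨ ∑ℕ-cong N (λ k _ → ℕₚ.*-suc (φ (suc k)) (coprimePairs (suc k) N)) ⟩
  ∑ℕ N (λ k → φ (suc k) + φ (suc k) * coprimePairs (suc k) N)
    ≡⟨ ∑ℕ-+ N (λ k → φ (suc k)) (λ k → φ (suc k) * coprimePairs (suc k) N) ⟩
  ∑ℕ N (λ k → φ (suc k)) + weightedPairs N N
    ≤⟨ ℕₚ.+-monoˡ-≤ (weightedPairs N N) (ℕₚ.≤-trans
         (∑ℕ-mono N (λ k k<N → ℕₚ.≤-trans (φ≤n (suc k)) k<N)) (ℕₚ.≤-reflexive (∑ℕ-const N N))) ⟩
  N * N + weightedPairs N N ∎
  where open ℕₚ.≤-Reasoning

weightedPairs-0 : ∀ K → weightedPairs K 0 ≡ 0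
weightedPairs-0 K = trans (∑ℕ-cong K (λ k _ → ℕₚ.*-zeroʳ (φ (suc k)))) (∑ℕ-0 K)

-- Rational arithmetic and inequalities for floors.

/-*-/ : ∀ a b c d .{{_ : ℕ.NonZero b}} .{{_ : ℕ.NonZero d}} .{{_ : ℕ.NonZero (b * d)}} →
        (+ a / b) ℚ.* (+ c / d) ≡ + (a * c) / (b * d)
/-*-/ a b@(suc b′) c d@(suc d′) = ℚₚ.toℚᵘ-injective (begin
  ℚ.toℚᵘ ((+ a / b) ℚ.* (+ c / d))           ≈⟨ ℚₚ.toℚᵘ-homo-* (+ a / b) (+ c / d) ⟩
  ℚ.toℚᵘ (+ a / b) ℚᵘ.* ℚ.toℚᵘ (+ c / d)     ≈⟨ ℚᵘₚ.*-cong (ℚₚ.toℚᵘ-fromℚᵘ (ℚᵘ.mkℚᵘ (+ a) b′))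
                                                            (ℚₚ.toℚᵘ-fromℚᵘ (ℚᵘ.mkℚᵘ (+ c) d′)) ⟩
  ℚᵘ.mkℚᵘ (+ a) b′ ℚᵘ.* ℚᵘ.mkℚᵘ (+ c) d′       ≡⟨ cong (λ z → ℚᵘ.mkℚᵘ z (d′ + b′ * d)) (sym (ℤₚ.pos-* a c)) ⟩
  ℚᵘ.mkℚᵘ (+ (a * c)) (d′ + b′ * d)                      ≈⟨ ℚᵘₚ.≃-sym (ℚₚ.toℚᵘ-fromℚᵘ (ℚᵘ.mkℚᵘ (+ (a * c)) (d′ + b′ * d))) ⟩
  ℚ.toℚᵘ (+ (a * c) / (b * d))               ∎)
  where open ℚᵘₚ.≃-Reasoning

ι : ℕ → ℚ
ι n = + n / 1

ι-+ : ∀ m n → ι (m + n) ≡ ι m ℚ.+ ι n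
ι-+ m n = sym (trans (/-+-/ m 1 n 1)
  (cong ι (cong₂ _+_ (ℕₚ.*-identityʳ m) (ℕₚ.*-identityʳ n))))

ι-* : ∀ m n → ι (m * n) ≡ ι m ℚ.* ι n
ι-* m n = sym (/-*-/ m 1 n 1)

ι-mono : ∀ {m n} → m ≤ n → ι m ℚ.≤ ι n
ι-mono {m} {n} m≤n = /-mono-≤ m 1 n 1 (ℕₚ.*-monoˡ-≤ 1 m≤n)

0≤ι : ∀ n → 0ℚ ℚ.≤ ι n
0≤ι n = 0≤a/b n 1

ι-*1/ : ∀ n d .{{_ : ℕ.NonZero d}} → ι n ℚ.* (+ 1 / d) ≡ + n / d
ι-*1/ n d@(suc _) = trans (/-*-/ n 1 1 d)
  (ℚₚ./-cong (cong +_ (ℕₚ.*-identityʳ n)) (ℕₚ.*-identityˡ d))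

ι-∑ℕ : ∀ n f → ι (∑ℕ n f) ≡ ∑ n (λ i → ι (f i))
ι-∑ℕ zero    f = refl
ι-∑ℕ (suc n) f = trans (ι-+ (∑ℕ n f) (f n)) (cong (ℚ._+ ι (f n)) (ι-∑ℕ n f))

∑-add : ∀ n f g → ∑ n (λ i → f i ℚ.+ g i) ≡ ∑ n f ℚ.+ ∑ n g
∑-add zero    f g = refl
∑-add (suc n) f g = trans (cong (ℚ._+ (f n ℚ.+ g n)) (∑-add n f g))
  (solve 4 (λ a b c d → (a :+ b) :+ (c :+ d) := (a :+ c) :+ (b :+ d)) refl (∑ n f) (∑ n g) (f n) (g n))
  where open ℚ-Solver

∑-*ˡ : ∀ n c f → ∑ n (λ i → c ℚ.* f i) ≡ c ℚ.* ∑ n f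
∑-*ˡ zero    c f = sym (ℚₚ.*-zeroʳ c)
∑-*ˡ (suc n) c f = trans (cong (ℚ._+ c ℚ.* f n) (∑-*ˡ n c f)) (sym (ℚₚ.*-distribˡ-+ c (∑ n f) (f n)))

∣∑∣≤∑∣∣ : ∀ n f → ℚ.∣ ∑ n f ∣ ℚ.≤ ∑ n (λ i → ℚ.∣ f i ∣)
∣∑∣≤∑∣∣ zero    f = ℚₚ.≤-refl
∣∑∣≤∑∣∣ (suc n) f = ℚₚ.≤-trans (ℚₚ.∣p+q∣≤∣p∣+∣q∣ (∑ n f) (f n))
  (ℚₚ.+-monoˡ-≤ ℚ.∣ f n ∣ (∣∑∣≤∑∣∣ n f))

*-monoˡ-≤ : ∀ {p q r} → 0ℚ ℚ.≤ r → p ℚ.≤ q → r ℚ.* p ℚ.≤ r ℚ.* q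
*-monoˡ-≤ {r = r} 0≤r = ℚₚ.*-monoˡ-≤-nonNeg r {{ℚ.nonNegative 0≤r}}

0≤p*q : ∀ {p q} → 0ℚ ℚ.≤ p → 0ℚ ℚ.≤ q → 0ℚ ℚ.≤ p ℚ.* q
0≤p*q {p} {q} 0≤p 0≤q = subst (ℚ._≤ p ℚ.* q) (ℚₚ.*-zeroʳ p) (*-monoˡ-≤ 0≤p 0≤q)

sq cube : ℚ → ℚ
sq x   = x ℚ.* x
cube x = x ℚ.* x ℚ.* x

0≤sq : ∀ {x} → 0ℚ ℚ.≤ x → 0ℚ ℚ.≤ sq x
0≤sq 0≤x = 0≤p*q 0≤x 0≤x

sq-mono : ∀ {x y} → 0ℚ ℚ.≤ x → x ℚ.≤ y → sq x ℚ.≤ sq y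
sq-mono 0≤x x≤y = *-mono-≤ 0≤x (ℚₚ.≤-trans 0≤x x≤y) x≤y x≤y

cube-mono : ∀ {x y} → 0ℚ ℚ.≤ x → x ℚ.≤ y → cube x ℚ.≤ cube y
cube-mono 0≤x x≤y = *-mono-≤ 0≤x (0≤sq (ℚₚ.≤-trans 0≤x x≤y)) (sq-mono 0≤x x≤y) x≤y

-- The three factors x are replaced one at a time by f + 1; since f ≤ x, each replacement costs at
-- most x².
cube≤cube-floor : ∀ {f x} → 0ℚ ℚ.≤ f → f ℚ.≤ x → x ℚ.≤ f ℚ.+ 1ℚ → cube x ℚ.≤ cube f ℚ.+ ι 3 ℚ.* sq x
cube≤cube-floor {f} {x} 0≤f f≤x x≤f+1 = begin
  cube x
    ≤⟨ *-monoˡ-≤ (0≤sq 0≤x) x≤f+1 ⟩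
  sq x ℚ.* (f ℚ.+ 1ℚ)
    ≡⟨ solve 2 (λ f x → x :* x :* (f :+ con 1ℚ) := x :* f :* x :+ x :* x) refl f x ⟩
  x ℚ.* f ℚ.* x ℚ.+ sq x
    ≤⟨ ℚₚ.+-monoˡ-≤ (sq x) (*-monoˡ-≤ (0≤p*q 0≤x 0≤f) x≤f+1) ⟩
  x ℚ.* f ℚ.* (f ℚ.+ 1ℚ) ℚ.+ sq x
    ≡⟨ solve 2 (λ f x → x :* f :* (f :+ con 1ℚ) :+ x :* x := f :* f :* x :+ (x :* f :+ x :* x)) refl f x ⟩
  sq f ℚ.* x ℚ.+ (x ℚ.* f ℚ.+ sq x)
    ≤⟨ ℚₚ.+-mono-≤ (*-monoˡ-≤ (0≤sq 0≤f) x≤f+1) (ℚₚ.+-monoˡ-≤ (sq x) (*-monoˡ-≤ 0≤x f≤x)) ⟩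
  sq f ℚ.* (f ℚ.+ 1ℚ) ℚ.+ (sq x ℚ.+ sq x)
    ≡⟨ solve 2 (λ f x → f :* f :* (f :+ con 1ℚ) :+ (x :* x :+ x :* x) :=
                        f :* f :+ (f :* f :* f :+ (x :* x :+ x :* x))) refl f x ⟩
  sq f ℚ.+ (cube f ℚ.+ (sq x ℚ.+ sq x))
    ≤⟨ ℚₚ.+-monoˡ-≤ (cube f ℚ.+ (sq x ℚ.+ sq x)) (sq-mono 0≤f f≤x) ⟩
  sq x ℚ.+ (cube f ℚ.+ (sq x ℚ.+ sq x))
    ≡⟨ solve 2 (λ f x → x :* x :+ (f :* f :* f :+ (x :* x :+ x :* x)) :=
                        f :* f :* f :+ con (ι 3) :* (x :* x)) refl f x ⟩
  cube f ℚ.+ ι 3 ℚ.* sq x ∎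
  where
  open ℚₚ.≤-Reasoning
  open ℚ-Solver
  0≤x : 0ℚ ℚ.≤ x
  0≤x = ℚₚ.≤-trans 0≤f f≤x

ι-div≤ : ∀ n d .{{_ : ℕ.NonZero d}} → ι (n div d) ℚ.≤ ι n ℚ.* (+ 1 / d)
ι-div≤ n d = subst (ι (n div d) ℚ.≤_) (sym (ι-*1/ n d))
  (/-mono-≤ (n div d) 1 n d (subst (n div d * d ≤_) (sym (ℕₚ.*-identityʳ n)) (m/n*n≤m n d)))

≤ι-div+1 : ∀ n d .{{_ : ℕ.NonZero d}} → ι n ℚ.* (+ 1 / d) ℚ.≤ ι (n div d) ℚ.+ 1ℚ
≤ι-div+1 n d = subst₂ ℚ._≤_ (sym (ι-*1/ n d)) (ι-+ (n div d) 1) (/-mono-≤ n d (n div d + 1) 1 (begin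
  n * 1                     ≡⟨ ℕₚ.*-identityʳ n ⟩
  n                         ≡⟨ m≡m%n+[m/n]*n n d ⟩
  n ℕ.% d + n div d * d     ≤⟨ ℕₚ.+-monoˡ-≤ (n div d * d) (ℕₚ.<⇒≤ (m%n<n n d)) ⟩
  suc (n div d) * d         ≡⟨ cong (_* d) (ℕₚ.+-comm 1 (n div d)) ⟩
  (n div d + 1) * d         ∎))
  where open ℕₚ.≤-Reasoning

-- Partial sums of ζ(2) and ζ(3), and the sum of cubed floors.

module ζ₂ = Zeta 2 (s≤s (s≤s z≤n))
module ζ₃ = Zeta 3 (s≤s (s≤s z≤n))

1/-cong : ∀ {a b} .{{_ : ℕ.NonZero a}} .{{_ : ℕ.NonZero b}} → a ≡ b → + 1 / a ≡ + 1 / b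
1/-cong refl = refl

ζ₂-term : ∀ i → ζ₂.term i ≡ sq (+ 1 / suc i)
ζ₂-term i = trans (1/-cong (cong (suc i *_) (ℕₚ.*-identityʳ (suc i)))) (sym (/-*-/ 1 (suc i) 1 (suc i)))

ζ₃-term : ∀ i → ζ₃.term i ≡ cube (+ 1 / suc i)
ζ₃-term i = trans (1/-cong (solve 1 (λ d → d :* (d :* (d :* con 1)) := d :* d :* d) refl (suc i)))
  (sym (trans (cong (ℚ._* (+ 1 / suc i)) (/-*-/ 1 (suc i) 1 (suc i))) (/-*-/ 1 (suc i * suc i) 1 (suc i))))
  where open ℕ-Solver

-- The tail bound after two terms: 1 + 1/4 + 1/2 = 7/4.
ζ₂≤7/4 : ∀ n → ζ₂.partial (suc n) ℚ.≤ + 7 / 4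
ζ₂≤7/4 n = ζ₂.bound n 1

ζ₃≤7/4 : ∀ n → ζ₃.partial (suc n) ℚ.≤ + 7 / 4
-- 13/8 = 1 + 1/8 + 1/2 is rounded up so that both zeta values share one bound.
ζ₃≤7/4 n = ℚₚ.≤-trans (ζ₃.bound n 1) (from-yes (+ 13 / 8 ℚₚ.≤? + 7 / 4))

cube-ι : ∀ n → cube (ι n) ≡ ι (n * n * n)
cube-ι n = sym (trans (ι-* (n * n) n) (cong (ℚ._* ι n) (ι-* n n)))

ι≤sq-ι : ∀ n → ι n ℚ.≤ sq (ι n)
ι≤sq-ι zero      = ℚₚ.≤-refl
ι≤sq-ι n@(suc _) = subst (ι n ℚ.≤_) (ι-* n n) (ι-mono (ℕₚ.m≤m*n n n))

ζ₃-mono : ∀ {m n} → m ≤ n → ζ₃.partial m ℚ.≤ ζ₃.partial n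
ζ₃-mono {m} {n} m≤n = subst (λ k → ζ₃.partial m ℚ.≤ ζ₃.partial k) (ℕₚ.m∸n+n≡m m≤n) (ζ₃.partial-mono m (n ℕ.∸ m))

∑-*sq : ∀ n x → ∑ n (λ i → sq (x ℚ.* (+ 1 / suc i))) ≡ sq x ℚ.* ζ₂.partial n
∑-*sq n x = trans
  (∑-cong n λ i → trans
    (solve 2 (λ x u → x :* u :* (x :* u) := x :* x :* (u :* u)) refl x (+ 1 / suc i))
    (cong (sq x ℚ.*_) (sym (ζ₂-term i))))
  (∑-*ˡ n (sq x) ζ₂.term)
  where open ℚ-Solver

∑-*cube : ∀ n x → ∑ n (λ i → cube (x ℚ.* (+ 1 / suc i))) ≡ cube x ℚ.* ζ₃.partial n
∑-*cube n x = trans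
  (∑-cong n λ i → trans
    (solve 2 (λ x u → x :* u :* (x :* u) :* (x :* u) := x :* x :* x :* (u :* u :* u)) refl x (+ 1 / suc i))
    (cong (cube x ℚ.*_) (sym (ζ₃-term i))))
  (∑-*ˡ n (cube x) ζ₃.term)
  where open ℚ-Solver

∑-cube-div : ℕ → ℚ
∑-cube-div n = ∑ n (λ i → cube (ι (n div suc i)))

-- Dropping the floors and lengthening the sum can only increase it. `suc D` is any truncation with
-- at least n terms, so the estimate is uniform in the approximation of ζ(3).
∑-cube-div≤ : ∀ {n D} → n ≤ suc D → ∑-cube-div n ℚ.≤ cube (ι n) ℚ.* ζ₃.partial (suc D)
∑-cube-div≤ {n} {D} n≤1+D = begin
  ∑-cube-div n
    ≤⟨ ∑-mono n (λ i _ → cube-mono (0≤ι (n div suc i)) (ι-div≤ n (suc i))) ⟩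
  ∑ n (λ i → cube (ι n ℚ.* (+ 1 / suc i)))
    ≡⟨ ∑-*cube n (ι n) ⟩
  cube (ι n) ℚ.* ζ₃.partial n
    ≤⟨ *-monoˡ-≤ (0≤p*q (0≤sq (0≤ι n)) (0≤ι n)) (ζ₃-mono n≤1+D) ⟩
  cube (ι n) ℚ.* ζ₃.partial (suc D) ∎
  where open ℚₚ.≤-Reasoning

-- Passing to the floor at d costs at most 3(n/d)², and 3 times the bound 7/4 for ζ(2) gives 21/4.
∑-cube-div≥ : ∀ {n D} → n ≤ suc D →
  cube (ι n) ℚ.* ζ₃.partial (suc D) ℚ.≤ ∑-cube-div n ℚ.+ + 21 / 4 ℚ.* sq (ι n)
∑-cube-div≥ {n} {D} n≤1+D = begin
  cube x ℚ.* ζ₃.partial (suc D)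
    ≡⟨ ∑-*cube (suc D) x ⟨
  ∑ (suc D) (λ i → cube (x ℚ.* (+ 1 / suc i)))
    ≤⟨ ∑-mono (suc D) (λ i _ → cube≤cube-floor (0≤ι (n div suc i)) (ι-div≤ n (suc i)) (≤ι-div+1 n (suc i))) ⟩
  ∑ (suc D) (λ i → cube (ι (n div suc i)) ℚ.+ ι 3 ℚ.* sq (x ℚ.* (+ 1 / suc i)))
    ≡⟨ ∑-add (suc D) (λ i → cube (ι (n div suc i))) (λ i → ι 3 ℚ.* sq (x ℚ.* (+ 1 / suc i))) ⟩
  ∑ (suc D) (λ i → cube (ι (n div suc i))) ℚ.+ ∑ (suc D) (λ i → ι 3 ℚ.* sq (x ℚ.* (+ 1 / suc i)))
    ≡⟨ cong₂ ℚ._+_ truncate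
         (trans (∑-*ˡ (suc D) (ι 3) (λ i → sq (x ℚ.* (+ 1 / suc i)))) (cong (ι 3 ℚ.*_) (∑-*sq (suc D) x))) ⟩
  ∑-cube-div n ℚ.+ ι 3 ℚ.* (sq x ℚ.* ζ₂.partial (suc D))
    ≤⟨ ℚₚ.+-monoʳ-≤ (∑-cube-div n) (*-monoˡ-≤ (0≤ι 3) (*-monoˡ-≤ (0≤sq (0≤ι n)) (ζ₂≤7/4 D))) ⟩
  ∑-cube-div n ℚ.+ ι 3 ℚ.* (sq x ℚ.* (+ 7 / 4))
    ≡⟨ cong (∑-cube-div n ℚ.+_)
         (solve 1 (λ s → con (ι 3) :* (s :* con (+ 7 / 4)) := con (+ 21 / 4) :* s) refl (sq x)) ⟩
  ∑-cube-div n ℚ.+ + 21 / 4 ℚ.* sq x ∎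
  where
  open ℚₚ.≤-Reasoning
  open ℚ-Solver
  x : ℚ
  x = ι n
  c : ℕ → ℕ
  c q = q * q * q
  -- `∑ℕ-truncate` concerns sums of naturals, hence the detour through `ι`; the summands with d > n
  -- drop out because ⌊n/d⌋ = 0.
  ∑-cube-ι : ∀ m → ∑ m (λ i → cube (ι (n div suc i))) ≡ ι (∑ℕ m (λ i → c (n div suc i)))
  ∑-cube-ι m = trans (∑-cong m (λ i → cube-ι (n div suc i))) (sym (ι-∑ℕ m _))
  truncate : ∑ (suc D) (λ i → cube (ι (n div suc i))) ≡ ∑-cube-div n
  truncate = trans (∑-cube-ι (suc D)) (trans
    (cong ι (∑ℕ-truncate _ n≤1+D λ i n≤i _ → cong c (m<n⇒m/n≡0 (s≤s n≤i))))
    (sym (∑-cube-ι n)))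

-- The error term, bounded by strong induction.

module Asymptotics (K D : ℕ) (K≤1+D : K ≤ suc D) (T : ℕ → ℕ) (T0≡0 : T 0 ≡ 0)
  (∑T : ∀ {n} → n ≤ K → 6 * ∑ℕ n (λ e → T (n div suc e)) ≡ n * suc n * suc (suc n)) where

  -- A partial sum stands in for ζ(3), so the induction stays in ℚ; the constants obtained do not
  -- depend on `D`.
  z : ℚ
  z = ζ₃.partial (suc D)

  0≤z : 0ℚ ℚ.≤ z
  0≤z = ζ₃-mono {0} {suc D} z≤n

  E : ℕ → ℚ
  E n = ι 6 ℚ.* z ℚ.* ι (T n) ℚ.- cube (ι n)

  -- Adding the cubed floors back leaves 6z times the sum of T(⌊n/d⌋), which the exact identity
  -- turns into z(n³ + 3n² + 2n).
  ∑E : ∀ {n} → n ≤ K → ∑ n (λ i → E (n div suc i)) ≡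
       (cube (ι n) ℚ.* z ℚ.+ z ℚ.* (ι 3 ℚ.* sq (ι n) ℚ.+ ι 2 ℚ.* ι n)) ℚ.- ∑-cube-div n
  ∑E {n} n≤K = begin
    e
      ≡⟨ solve 2 (λ e c → e := (e :+ c) :- c) refl e (∑-cube-div n) ⟩
    (e ℚ.+ ∑-cube-div n) ℚ.- ∑-cube-div n
      ≡⟨ cong (ℚ._- ∑-cube-div n) (begin
           e ℚ.+ ∑-cube-div n
             ≡⟨ ∑-add n (λ i → E (n div suc i)) (λ i → cube (ι (n div suc i))) ⟨
           ∑ n (λ i → E (n div suc i) ℚ.+ cube (ι (n div suc i)))
             ≡⟨ ∑-cong n (λ i → solve 2 (λ a b → (a :- b) :+ b := a) refl
                  (ι 6 ℚ.* z ℚ.* ι (T (n div suc i))) (cube (ι (n div suc i)))) ⟩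
           ∑ n (λ i → ι 6 ℚ.* z ℚ.* ι (T (n div suc i)))
             ≡⟨ ∑-*ˡ n (ι 6 ℚ.* z) (λ i → ι (T (n div suc i))) ⟩
           ι 6 ℚ.* z ℚ.* ∑ n (λ i → ι (T (n div suc i)))
             ≡⟨ cong (ι 6 ℚ.* z ℚ.*_) (ι-∑ℕ n (λ i → T (n div suc i))) ⟨
           ι 6 ℚ.* z ℚ.* ι (∑ℕ n (λ i → T (n div suc i)))
             ≡⟨ solve 3 (λ a b c → a :* b :* c := b :* (a :* c)) refl (ι 6) z (ι (∑ℕ n (λ i → T (n div suc i)))) ⟩
           z ℚ.* (ι 6 ℚ.* ι (∑ℕ n (λ i → T (n div suc i))))
             ≡⟨ cong (z ℚ.*_) (trans (sym (ι-* 6 (∑ℕ n (λ i → T (n div suc i))))) (trans (cong ι (∑T n≤K)) polynomial)) ⟩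
           z ℚ.* (cube (ι n) ℚ.+ (ι 3 ℚ.* sq (ι n) ℚ.+ ι 2 ℚ.* ι n))
             ≡⟨ solve 3 (λ a b c → a :* (b :+ c) := b :* a :+ a :* c) refl
                  z (cube (ι n)) (ι 3 ℚ.* sq (ι n) ℚ.+ ι 2 ℚ.* ι n) ⟩
           cube (ι n) ℚ.* z ℚ.+ z ℚ.* (ι 3 ℚ.* sq (ι n) ℚ.+ ι 2 ℚ.* ι n) ∎) ⟩
    (cube (ι n) ℚ.* z ℚ.+ z ℚ.* (ι 3 ℚ.* sq (ι n) ℚ.+ ι 2 ℚ.* ι n)) ℚ.- ∑-cube-div n ∎
    where
    open ≡-Reasoning
    open ℚ-Solver
    e : ℚ
    e = ∑ n (λ i → E (n div suc i))
    polynomial : ι (n * suc n * suc (suc n)) ≡ cube (ι n) ℚ.+ (ι 3 ℚ.* sq (ι n) ℚ.+ ι 2 ℚ.* ι n)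
    polynomial = begin
      ι (n * suc n * suc (suc n))
        ≡⟨ trans (ι-* (n * suc n) (suc (suc n))) (cong (ℚ._* ι (suc (suc n))) (ι-* n (suc n))) ⟩
      ι n ℚ.* ι (suc n) ℚ.* ι (suc (suc n))
        ≡⟨ cong₂ (λ a b → ι n ℚ.* a ℚ.* b) (ι-+ 1 n) (ι-+ 2 n) ⟩
      ι n ℚ.* (ι 1 ℚ.+ ι n) ℚ.* (ι 2 ℚ.+ ι n)
        ≡⟨ solve 1 (λ x → x :* (con (ι 1) :+ x) :* (con (ι 2) :+ x) :=
             x :* x :* x :+ (con (ι 3) :* (x :* x) :+ con (ι 2) :* x)) refl (ι n) ⟩
      cube (ι n) ℚ.+ (ι 3 ℚ.* sq (ι n) ℚ.+ ι 2 ℚ.* ι n) ∎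

  -- 14 = 21/4 + 5 · 7/4: the first part pays for the floors, the second bounds z(3n² + 2n) using n
  -- ≤ n². The sum is nonnegative by `∑-cube-div≤`, which settles the other direction.
  ∣∑E∣≤ : ∀ {n} → n ≤ K → ℚ.∣ ∑ n (λ i → E (n div suc i)) ∣ ℚ.≤ ι 14 ℚ.* sq (ι n)
  ∣∑E∣≤ {n} n≤K = subst (λ e → ℚ.∣ e ∣ ℚ.≤ ι 14 ℚ.* sq x) (sym (∑E n≤K)) (∣p-q∣≤r upper lower)
    where
    open ℚₚ.≤-Reasoning
    open ℚ-Solver
    x y : ℚ
    x = ι n
    y = ι 3 ℚ.* sq x ℚ.+ ι 2 ℚ.* x
    n≤1+D : n ≤ suc D
    n≤1+D = ℕₚ.≤-trans n≤K K≤1+D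
    0≤y : 0ℚ ℚ.≤ y
    0≤y = ℚₚ.+-mono-≤ (0≤p*q (0≤ι 3) (0≤sq (0≤ι n))) (0≤p*q (0≤ι 2) (0≤ι n))
    y≤5x² : y ℚ.≤ ι 5 ℚ.* sq x
    y≤5x² = begin
      y                                ≤⟨ ℚₚ.+-monoʳ-≤ (ι 3 ℚ.* sq x) (*-monoˡ-≤ (0≤ι 2) (ι≤sq-ι n)) ⟩
      ι 3 ℚ.* sq x ℚ.+ ι 2 ℚ.* sq x    ≡⟨ ℚₚ.*-distribʳ-+ (sq x) (ι 3) (ι 2) ⟨
      ι 5 ℚ.* sq x                     ∎
    upper : cube x ℚ.* z ℚ.+ z ℚ.* y ℚ.≤ ∑-cube-div n ℚ.+ ι 14 ℚ.* sq x
    upper = begin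
      cube x ℚ.* z ℚ.+ z ℚ.* y
        ≤⟨ ℚₚ.+-mono-≤ (∑-cube-div≥ n≤1+D)
             (*-mono-≤ 0≤y (0≤a/b 7 4) (ζ₃≤7/4 D) y≤5x²) ⟩
      (∑-cube-div n ℚ.+ + 21 / 4 ℚ.* sq x) ℚ.+ + 7 / 4 ℚ.* (ι 5 ℚ.* sq x)
        ≡⟨ solve 2 (λ c s → (c :+ con (+ 21 / 4) :* s) :+ con (+ 7 / 4) :* (con (ι 5) :* s) :=
                            c :+ con (ι 14) :* s) refl (∑-cube-div n) (sq x) ⟩
      ∑-cube-div n ℚ.+ ι 14 ℚ.* sq x ∎
    lower : ∑-cube-div n ℚ.≤ cube x ℚ.* z ℚ.+ z ℚ.* y ℚ.+ ι 14 ℚ.* sq x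
    lower = begin
      ∑-cube-div n
        ≤⟨ ∑-cube-div≤ n≤1+D ⟩
      cube x ℚ.* z
        ≡⟨ solve 1 (λ a → a := a :+ con 0ℚ :+ con 0ℚ) refl (cube x ℚ.* z) ⟩
      cube x ℚ.* z ℚ.+ 0ℚ ℚ.+ 0ℚ
        ≤⟨ ℚₚ.+-mono-≤ (ℚₚ.+-monoʳ-≤ (cube x ℚ.* z) (0≤p*q 0≤z 0≤y)) (0≤p*q (0≤ι 14) (0≤sq (0≤ι n))) ⟩
      cube x ℚ.* z ℚ.+ z ℚ.* y ℚ.+ ι 14 ℚ.* sq x ∎

  -- Removing the leading 1 from 7/4 leaves 3/4, the contraction factor of the induction.
  ∑-ζ₂-tail : ∀ m → ∑ m (λ i → ζ₂.term (suc i)) ℚ.≤ + 3 / 4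
  ∑-ζ₂-tail m = subst (ℚ._≤ + 3 / 4)
    (solve 1 (λ a → (a :+ con 1ℚ) :- con 1ℚ := a) refl (∑ m (λ i → ζ₂.term (suc i))))
    (ℚₚ.+-monoˡ-≤ (ℚ.- 1ℚ) (subst (ℚ._≤ + 7 / 4) (sym (∑-shift m ζ₂.term)) (ζ₂≤7/4 m)))
    where open ℚ-Solver

  -- 56 is the solution of C = 14 + (3/4) C.
  ∣E∣≤ : ∀ n → n ≤ K → ℚ.∣ E n ∣ ℚ.≤ ι 56 ℚ.* sq (ι n)
  ∣E∣≤ = <-rec (λ n → n ≤ K → ℚ.∣ E n ∣ ℚ.≤ ι 56 ℚ.* sq (ι n)) step
    where
    open ℚₚ.≤-Reasoning
    open ℚ-Solver
    step : ∀ n → (∀ {m} → m < n → m ≤ K → ℚ.∣ E m ∣ ℚ.≤ ι 56 ℚ.* sq (ι m)) →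
           n ≤ K → ℚ.∣ E n ∣ ℚ.≤ ι 56 ℚ.* sq (ι n)
    step zero _ _ = ℚₚ.≤-reflexive (cong ℚ.∣_∣ (trans
      (cong (λ t → ι 6 ℚ.* z ℚ.* ι t ℚ.- cube (ι 0)) T0≡0)
      (solve 1 (λ z → con (ι 6) :* z :* con 0ℚ :- con 0ℚ := con 0ℚ) refl z)))
    step n@(suc m) rec n≤K = begin
      ℚ.∣ E n ∣
        ≡⟨ cong ℚ.∣_∣ E≡ ⟩
      ℚ.∣ ∑ n f ℚ.- ∑ m (λ i → f (suc i)) ∣
        ≤⟨ ℚₚ.∣p-q∣≤∣p∣+∣q∣ (∑ n f) (∑ m (λ i → f (suc i))) ⟩
      ℚ.∣ ∑ n f ∣ ℚ.+ ℚ.∣ ∑ m (λ i → f (suc i)) ∣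
        ≤⟨ ℚₚ.+-mono-≤ (∣∑E∣≤ n≤K) rest ⟩
      ι 14 ℚ.* sq x ℚ.+ ι 56 ℚ.* sq x ℚ.* (+ 3 / 4)
        ≡⟨ solve 1 (λ s → con (ι 14) :* s :+ con (ι 56) :* s :* con (+ 3 / 4) := con (ι 56) :* s) refl (sq x) ⟩
      ι 56 ℚ.* sq x ∎
      where
      x : ℚ
      x = ι n
      f : ℕ → ℚ
      f i = E (n div suc i)
      -- The summand d = 1 is E(n) itself; the others have d ≥ 2, hence ⌊n/d⌋ < n, and fall under
      -- the induction hypothesis.
      E≡ : E n ≡ ∑ n f ℚ.- ∑ m (λ i → f (suc i))
      E≡ = trans (cong E (sym (n/1≡n n))) (trans
        (solve 2 (λ a b → b := (a :+ b) :- a) refl (∑ m (λ i → f (suc i))) (f 0))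
        (cong (ℚ._- ∑ m (λ i → f (suc i))) (∑-shift m f)))
      rest : ℚ.∣ ∑ m (λ i → f (suc i)) ∣ ℚ.≤ ι 56 ℚ.* sq x ℚ.* (+ 3 / 4)
      rest = begin
        ℚ.∣ ∑ m (λ i → f (suc i)) ∣
          ≤⟨ ∣∑∣≤∑∣∣ m (λ i → f (suc i)) ⟩
        ∑ m (λ i → ℚ.∣ f (suc i) ∣)
          ≤⟨ ∑-mono m (λ i _ → begin
               ℚ.∣ f (suc i) ∣
                 ≤⟨ rec (m/n<m n (suc (suc i)) (s≤s (s≤s z≤n))) (ℕₚ.≤-trans (m/n≤m n (suc (suc i))) n≤K) ⟩
               ι 56 ℚ.* sq (ι (n div suc (suc i)))
                 ≤⟨ *-monoˡ-≤ (0≤ι 56) (sq-mono (0≤ι (n div suc (suc i))) (ι-div≤ n (suc (suc i)))) ⟩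
               ι 56 ℚ.* sq (x ℚ.* (+ 1 / suc (suc i)))
                 ≡⟨ solve 2 (λ x u → con (ι 56) :* (x :* u :* (x :* u)) := con (ι 56) :* (x :* x) :* (u :* u))
                      refl x (+ 1 / suc (suc i)) ⟩
               ι 56 ℚ.* sq x ℚ.* sq (+ 1 / suc (suc i))
                 ≡⟨ cong (ι 56 ℚ.* sq x ℚ.*_) (ζ₂-term (suc i)) ⟨
               ι 56 ℚ.* sq x ℚ.* ζ₂.term (suc i) ∎) ⟩
        ∑ m (λ i → ι 56 ℚ.* sq x ℚ.* ζ₂.term (suc i))
          ≡⟨ ∑-*ˡ m (ι 56 ℚ.* sq x) (λ i → ζ₂.term (suc i)) ⟩
        ι 56 ℚ.* sq x ℚ.* ∑ m (λ i → ζ₂.term (suc i))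
          ≤⟨ *-monoˡ-≤ (0≤p*q (0≤ι 56) (0≤sq (0≤ι n))) (∑-ζ₂-tail m) ⟩
        ι 56 ℚ.* sq x ℚ.* (+ 3 / 4) ∎

-- Passage to the real numbers.

-- The integrand 1/t is at most 1 on [1, N]: each of the (N - 1)(k + 1) summands is at most 1/(k +
-- 1).
log≤N : ∀ N k → Log.right N (suc k) ℚ.≤ ι N
log≤N N k = begin
  Log.right N (suc k)
    ≤⟨ ∑-mono ((N ℕ.∸ 1) * suc k) (λ i _ →
         1/-anti-≤ (suc k) (suc (i + suc k)) (ℕₚ.m≤n⇒m≤1+n (ℕₚ.m≤n+m (suc k) i))) ⟩
  ∑ ((N ℕ.∸ 1) * suc k) (λ _ → + 1 / suc k)
    ≡⟨ ∑-const ((N ℕ.∸ 1) * suc k) (suc k) ⟩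
  + ((N ℕ.∸ 1) * suc k) / suc k
    ≤⟨ /-mono-≤ ((N ℕ.∸ 1) * suc k) (suc k) N 1
         (subst (_≤ N * suc k) (sym (ℕₚ.*-identityʳ _)) (ℕₚ.*-monoˡ-≤ (suc k) (ℕₚ.m∸n≤m N 1))) ⟩
  ι N ∎
  where open ℚₚ.≤-Reasoning

weightedPairs-asymptotics : ∀ {N D} → N ≤ suc D →
  ℚ.∣ ι 6 ℚ.* ζ₃.partial (suc D) ℚ.* ι (weightedPairs N N) ℚ.- cube (ι N) ∣ ℚ.≤ ι 56 ℚ.* sq (ι N)
weightedPairs-asymptotics {N} {D} N≤1+D =
  Asymptotics.∣E∣≤ N D N≤1+D (weightedPairs N) (weightedPairs-0 N) ∑-weightedPairs N ℕₚ.≤-refl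

-- In use, s is the sum of the theorem, t the weighted pair count, x = N, and w, r, l approximate
-- 6ζ(3), its reciprocal and 1/log N. The split s - x³r = (s - t) + (wt - x³)r gives an error O(x²),
-- and 1 ≤ xl trades x² for x³l.
error-bound : ∀ {s t x w r l} → ℚ.∣ w ℚ.* t ℚ.- cube x ∣ ℚ.≤ ι 56 ℚ.* sq x →
  t ℚ.≤ s → s ℚ.≤ sq x ℚ.+ t → w ℚ.* r ≡ 1ℚ → 0ℚ ℚ.≤ r → r ℚ.≤ 1ℚ → 0ℚ ℚ.≤ x → 1ℚ ℚ.≤ x ℚ.* l →
  ℚ.∣ s ℚ.- cube x ℚ.* r ∣ ℚ.≤ ι 57 ℚ.* (cube x ℚ.* l)
error-bound {s} {t} {x} {w} {r} {l} asymptotics t≤s s≤x²+t wr≡1 0≤r r≤1 0≤x 1≤xl = begin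
  ℚ.∣ s ℚ.- cube x ℚ.* r ∣
    ≡⟨ cong ℚ.∣_∣ (begin-equality
         s ℚ.- cube x ℚ.* r
           ≡⟨ solve 4 (λ s t c r → s :- c :* r := (s :- t) :+ (t :* con 1ℚ :- c :* r)) refl s t (cube x) r ⟩
         (s ℚ.- t) ℚ.+ (t ℚ.* 1ℚ ℚ.- cube x ℚ.* r)
           ≡⟨ cong (λ p → (s ℚ.- t) ℚ.+ (t ℚ.* p ℚ.- cube x ℚ.* r)) wr≡1 ⟨
         (s ℚ.- t) ℚ.+ (t ℚ.* (w ℚ.* r) ℚ.- cube x ℚ.* r)
           ≡⟨ solve 5 (λ s t w c r → (s :- t) :+ (t :* (w :* r) :- c :* r) := (s :- t) :+ (w :* t :- c) :* r)
                refl s t w (cube x) r ⟩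
         (s ℚ.- t) ℚ.+ (w ℚ.* t ℚ.- cube x) ℚ.* r ∎) ⟩
  ℚ.∣ (s ℚ.- t) ℚ.+ (w ℚ.* t ℚ.- cube x) ℚ.* r ∣
    ≤⟨ ℚₚ.∣p+q∣≤∣p∣+∣q∣ (s ℚ.- t) ((w ℚ.* t ℚ.- cube x) ℚ.* r) ⟩
  ℚ.∣ s ℚ.- t ∣ ℚ.+ ℚ.∣ (w ℚ.* t ℚ.- cube x) ℚ.* r ∣
    ≡⟨ cong (ℚ.∣ s ℚ.- t ∣ ℚ.+_) (trans (ℚₚ.∣p*q∣≡∣p∣*∣q∣ (w ℚ.* t ℚ.- cube x) r)
         (cong (ℚ.∣ w ℚ.* t ℚ.- cube x ∣ ℚ.*_) (ℚₚ.0≤p⇒∣p∣≡p 0≤r))) ⟩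
  ℚ.∣ s ℚ.- t ∣ ℚ.+ ℚ.∣ w ℚ.* t ℚ.- cube x ∣ ℚ.* r
    ≤⟨ ℚₚ.+-mono-≤ (∣p-q∣≤r (subst (s ℚ.≤_) (ℚₚ.+-comm (sq x) t) s≤x²+t) t≤s+x²)
         (*-mono-≤ 0≤r (0≤p*q (0≤ι 56) (0≤sq 0≤x)) asymptotics r≤1) ⟩
  sq x ℚ.+ ι 56 ℚ.* sq x ℚ.* 1ℚ
    ≡⟨ solve 1 (λ s → s :+ con (ι 56) :* s :* con 1ℚ := con (ι 57) :* (s :* con 1ℚ)) refl (sq x) ⟩
  ι 57 ℚ.* (sq x ℚ.* 1ℚ)
    ≤⟨ *-monoˡ-≤ (0≤ι 57) (*-monoˡ-≤ (0≤sq 0≤x) 1≤xl) ⟩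
  ι 57 ℚ.* (sq x ℚ.* (x ℚ.* l))
    ≡⟨ cong (ι 57 ℚ.*_) (sym (ℚₚ.*-assoc (sq x) x l)) ⟩
  ι 57 ℚ.* (cube x ℚ.* l) ∎
  where
  open ℚₚ.≤-Reasoning
  open ℚ-Solver
  t≤s+x² : t ℚ.≤ s ℚ.+ sq x
  t≤s+x² = subst (ℚ._≤ s ℚ.+ sq x) (ℚₚ.+-identityʳ t) (ℚₚ.+-mono-≤ t≤s (0≤sq 0≤x))

module _ (x : ℝ) (0<x : 0ℝ <ℝ x) where
  open Reciprocal x 0<x

  private
    M : ℕ
    M = proj₁ (proj₂ (proj₂ 0<x))

    y≡x : ∀ {n} → M ≤ n → y n ≡ seq x n
    y≡x {n} M≤n = ℚₚ.p≥q⇒p⊔q≡p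
      (subst (ℚ._≤ seq x n) (ℚₚ.+-identityˡ ε) (proj₂ (proj₂ (proj₂ 0<x)) n M≤n))

  -- Beyond `M` the cut-off `seq x n ⊔ ε` is `seq x n` itself, so the reciprocal is exact term by
  -- term.
  eventually-*-reciprocal : ∃[ M ] (∀ n → M ≤ n → seq x n ℚ.* seq reciprocal n ≡ 1ℚ)
  eventually-*-reciprocal = M , λ n M≤n →
    trans (cong (ℚ._* ry n) (sym (y≡x M≤n))) (y*ry n)

  0≤reciprocal : ∀ n → 0ℚ ℚ.≤ seq reciprocal n
  0≤reciprocal = ry≥0

-- `r` and `l` stand for the reciprocals of 6ζ(3) and log N, known only through their sign and the
-- eventual termwise inverse property.
∑φI-asymptotics : ∀ N r l → (∀ n → 0ℚ ℚ.≤ seq r n) → (∀ n → 0ℚ ℚ.≤ seq l n) →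
  ∃[ M ] (∀ n → M ≤ n → ι 6 ℚ.* ζ₃.partial (suc n) ℚ.* seq r n ≡ 1ℚ) →
  ∃[ M ] (∀ n → M ≤ n → Log.right N (suc n) ℚ.* seq l n ≡ 1ℚ) →
  ∣ fromℕ (∑φI N) -ℝ fromℕ (N ^ 3) *ℝ r ∣ℝ ≤ℝ fromℕ 57 *ℝ (fromℕ (N ^ 3) *ℝ l)
-- Including `N` in the threshold makes the partial sum of ζ(3) long enough for
-- `weightedPairs-asymptotics`. The inequality then holds termwise and ε is merely added.
∑φI-asymptotics N r l 0≤r 0≤l (M₁ , 6ζr≡1) (M₂ , log*l≡1) ε 0<ε = N ℕ.⊔ (M₁ ℕ.⊔ M₂) , λ n M≤n →
  let N≤n    = ℕₚ.m⊔n≤o⇒m≤o N (M₁ ℕ.⊔ M₂) M≤n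
      M₁⊔M₂≤n = ℕₚ.m⊔n≤o⇒n≤o N (M₁ ℕ.⊔ M₂) M≤n
      M₁≤n   = ℕₚ.m⊔n≤o⇒m≤o M₁ M₂ M₁⊔M₂≤n
      M₂≤n   = ℕₚ.m⊔n≤o⇒n≤o M₁ M₂ M₁⊔M₂≤n
      -- The first term of ζ(3) is 1, so 6ζ(3) ≥ 1 and its reciprocal is at most 1.
      1≤6ζ   = *-mono-≤ {1ℚ} {ι 6} {1ℚ} {ζ₃.partial (suc n)} (0≤ι 1) (0≤ι 6) (ι-mono {1} {6} (s≤s z≤n))
                 (ζ₃-mono {1} {suc n} (s≤s z≤n))
  in begin
    ℚ.∣ ι (∑φI N) ℚ.- ι (N ^ 3) ℚ.* seq r n ∣
      ≡⟨ cong (λ c → ℚ.∣ ι (∑φI N) ℚ.- c ℚ.* seq r n ∣) ιN³ ⟩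
    ℚ.∣ ι (∑φI N) ℚ.- cube (ι N) ℚ.* seq r n ∣
      ≤⟨ error-bound {ι (∑φI N)} {ι (weightedPairs N N)} {ι N} {ι 6 ℚ.* ζ₃.partial (suc n)} {seq r n} {seq l n}
           (weightedPairs-asymptotics (ℕₚ.m≤n⇒m≤1+n N≤n))
           (ι-mono (weightedPairs≤∑φI N))
           (subst (ι (∑φI N) ℚ.≤_)
             (trans (ι-+ (N * N) (weightedPairs N N)) (cong (ℚ._+ ι (weightedPairs N N)) (ι-* N N)))
             (ι-mono (∑φI≤N²+weightedPairs N)))
           (6ζr≡1 n M₁≤n) (0≤r n)
           (subst₂ ℚ._≤_ (ℚₚ.*-identityˡ (seq r n)) (6ζr≡1 n M₁≤n)
             (*-mono-≤ (0≤r n) (ℚₚ.≤-trans (0≤ι 1) 1≤6ζ) 1≤6ζ ℚₚ.≤-refl))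
           (0≤ι N)
           (subst (ℚ._≤ ι N ℚ.* seq l n) (log*l≡1 n M₂≤n)
             (*-mono-≤ (0≤l n) (0≤ι N) (log≤N N n) ℚₚ.≤-refl)) ⟩
    ι 57 ℚ.* (cube (ι N) ℚ.* seq l n)
      ≡⟨ cong (λ c → ι 57 ℚ.* (c ℚ.* seq l n)) ιN³ ⟨
    ι 57 ℚ.* (ι (N ^ 3) ℚ.* seq l n)
      ≡⟨ ℚₚ.+-identityʳ (ι 57 ℚ.* (ι (N ^ 3) ℚ.* seq l n)) ⟨
    ι 57 ℚ.* (ι (N ^ 3) ℚ.* seq l n) ℚ.+ 0ℚ
      ≤⟨ ℚₚ.+-monoʳ-≤ (ι 57 ℚ.* (ι (N ^ 3) ℚ.* seq l n)) (ℚₚ.<⇒≤ 0<ε) ⟩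
    ι 57 ℚ.* (ι (N ^ 3) ℚ.* seq l n) ℚ.+ ε ∎
  where
  open ℚₚ.≤-Reasoning
  ιN³ : ι (N ^ 3) ≡ cube (ι N)
  ιN³ = trans (cong ι (trans (cong (λ k → N * (N * k)) (ℕₚ.*-identityʳ N)) (sym (ℕₚ.*-assoc N N N))))
    (sym (cube-ι N))

theorem4 : ∃[ C ] ∀ (N : ℕ) (N≥2 : 2 ≤ N) →
  let S = sum (tabulate {n = N} λ i → φ (suc (toℕ i)) * I N (+ 1 / suc (toℕ i)) (1/k∈farey i))
      2≤3 = s≤s (s≤s z≤n)
      0<6ζ3 = 0<*ℝ (fromℕ 6) (ζ 3 2≤3) (0<fromℕ-suc 5) (0<ζ 3 2≤3)
  in ∣ fromℕ S -ℝ fromℕ (N ^ 3) ÷ℝ (fromℕ 6 *ℝ ζ 3 2≤3) [ 0<6ζ3 ] ∣ℝ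
       ≤ℝ C *ℝ (fromℕ (N ^ 3) ÷ℝ log N [ 0<log N≥2 ])
-- 57 = 56 + 1: the induction constant, and 1 for the distance of at most N² between the sum and the
-- weighted pair count.
theorem4 = fromℕ 57 , λ N N≥2 →
  let 6ζ3   = fromℕ 6 *ℝ ζ 3 (s≤s (s≤s z≤n))
      0<6ζ3 = 0<*ℝ (fromℕ 6) (ζ 3 (s≤s (s≤s z≤n))) (0<fromℕ-suc 5) (0<ζ 3 (s≤s (s≤s z≤n)))
  in ∑φI-asymptotics N
       (Reciprocal.reciprocal 6ζ3 0<6ζ3) (Reciprocal.reciprocal (log N) (0<log N≥2))
       (0≤reciprocal 6ζ3 0<6ζ3) (0≤reciprocal (log N) (0<log N≥2))
       (eventually-*-reciprocal 6ζ3 0<6ζ3) (eventually-*-reciprocal (log N) (0<log N≥2))
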